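{- Let $n\ge 2$ be an integer and let $D$ be the set of positive divisors of $n$. Let $G=\langle a\rangle$ be a cyclic group of order $n$ and let $S=\{a^{i} : i\in B(1,n)\}$, where $B(1,n)=\{t\in\mathbb{N} : 1\le t\le n,\ \gcd(t,n)=1\}$. Let $X=\{x\in D : p^2\mid x \text{ for some prime } p\}$. Then for every $d\in D$: (1) if $n$ is divisible by the square of a prime, then $M(X_S(G))\ge \max\Big\{\sum_{x\in X}\phi(x),\ \phi(d)\Big\}$; (2) if $n$ is square-free, then $M(X_S(G))\ge \phi(d)$.
   Context: $\phi$ denotes Euler's totient function. For a finite group $G$ and a subset $S\subseteq G$ closed under inverses and not containing the identity, the Cayley graph $X_S(G)$ is the simple undirected graph with vertex set $G$ in which $g_1$ and $g_2$ are adjacent iff $g_1g_2^{ -1}\in S$. For a simple graph $\mathcal{G}$ on vertices $u_1,\ldots,u_N$, let $S(\mathcal{G})$ be the set of real symmetric $N\times N$ matrices $A=(a_{ij})$ such that, for all $i\ne j$, $a_{ij}\neq 0$ iff $u_i$ and $u_j$ are adjacent (the diagonal entries are arbitrary). The maximum nullity $M(\mathcal{G})$ is the maximum of the nullities (dimensions of the kernels) of the matrices in $S(\mathcal{G})$. -}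

module Defs where

open import Algebra.Bundles using (Group; CommutativeRing)
import Algebra.Definitions.RawMonoid as RawMonoidOps
import Algebra.Properties.Group as GroupProperties
import Algebra.Properties.Ring as RingProperties
import Algebra.Properties.Monoid.Mult as MonoidMult
open import Data.Empty using (⊥)
open import Data.Fin.Base as Fin using (Fin; toℕ; fromℕ<)
import Data.Fin.Properties as Finₚ
open import Data.Integer.Base as ℤ using (ℤ)
open import Data.List.Base using (List; filter; length; map; upTo)
open import Data.Nat.Base as ℕ using (ℕ; zero; suc; _≤_; s≤s; _∸_)
open import Data.Nat.Coprimality using (coprime⇒gcd≡1; gcd≡1⇒coprime)
open import Data.Nat.Divisibility using (_∣_; _∣?_; ∣⇒≤; ∣m+n∣m⇒∣n; ∣-refl; ∣-trans; m∣m*n; _∣0)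
open import Data.Nat.DivMod using (_%_; _/_; m≡m%n+[m/n]*n; m%n<n)
open import Data.Nat.GCD using (gcd)
open import Data.Nat.Primality using (Prime; prime?; prime[2])
open import Data.Nat.ListAction using (sum)
import Data.Nat.Properties as ℕₚ
open import Data.Product.Base using (∃; ∃₂; _×_; _,_; proj₁; proj₂)
open import Data.Rational.Base as ℚ using (ℚ; 0ℚ; 1ℚ; ½; ∣_∣)
import Data.Rational.Properties as ℚₚ
import Data.Rational.Solver as ℚSolver
open import Data.Vec.Functional using (Vector)
open import Function.Bundles using (Inverse; _⇔_)
open import Level using (_⊔_; 0ℓ) renaming (suc to lsuc)
open import Relation.Binary.Bundles using (Setoid)
open import Relation.Binary.Core using (Rel)
open import Relation.Binary.Definitions using (Symmetric; _Respects_; _Respects₂_)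
open import Relation.Binary.PropositionalEquality
  using (_≡_; _≢_; refl; sym; trans; cong; cong₂; subst)
import Relation.Binary.PropositionalEquality.Properties as ≡ₚ
open import Relation.Nullary.Decidable using (yes; no; map′; _×-dec_)
open import Relation.Nullary.Negation using (¬_; contradiction)
open import Relation.Unary using (Pred; Decidable)

-- Close f g says that f m - g n tends to 0 as m and n tend to infinity
-- independently: Close f f is the Cauchy condition, and for Cauchy
-- sequences Close f g is equivalent to f n - g n being a null sequence.

Close : Rel (ℕ → ℚ) 0ℓ
Close f g = ∀ ε → 0ℚ ℚ.< ε →
  ∃ λ N → ∀ {m n} → N ≤ m → N ≤ n → ∣ f m ℚ.- g n ∣ ℚ.< ε

record ℝ : Set where
  constructor mkℝ
  field
    seq    : ℕ → ℚ
    cauchy : Close seq seq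

open ℝ public

infix 4 _≃_
record _≃_ (x y : ℝ) : Set where
  constructor mk≃
  field
    close : Close (seq x) (seq y)

open _≃_ public

module _ where
  open ℚSolver.+-*-Solver
  open RingProperties ℚₚ.+-*-ring using (x[y-z]≈xy-xz; [y-z]x≈yx-zx)

  private
    ∣p-q∣≡∣q-p∣ : ∀ p q → ∣ p ℚ.- q ∣ ≡ ∣ q ℚ.- p ∣
    ∣p-q∣≡∣q-p∣ p q = trans (sym (ℚₚ.∣-p∣≡∣p∣ (p ℚ.- q)))
      (cong ∣_∣ (solve 2 (λ p q → :- (p :- q) := q :- p) refl p q))

    triangle : ∀ p q r → ∣ p ℚ.- r ∣ ℚ.≤ ∣ p ℚ.- q ∣ ℚ.+ ∣ q ℚ.- r ∣
    triangle p q r = subst (ℚ._≤ ∣ p ℚ.- q ∣ ℚ.+ ∣ q ℚ.- r ∣)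
      (cong ∣_∣ (solve 3 (λ p q r → (p :- q) :+ (q :- r) := p :- r) refl p q r))
      (ℚₚ.∣p+q∣≤∣p∣+∣q∣ (p ℚ.- q) (q ℚ.- r))

    half>0 : ∀ {ε} → 0ℚ ℚ.< ε → 0ℚ ℚ.< ε ℚ.* ½
    half>0 {ε} 0<ε = subst (ℚ._< ε ℚ.* ½) (ℚₚ.*-zeroˡ ½) (ℚₚ.*-monoˡ-<-pos ½ 0<ε)

    half+half : ∀ ε → ε ℚ.* ½ ℚ.+ ε ℚ.* ½ ≡ ε
    half+half ε = trans (sym (ℚₚ.*-distribˡ-+ ε ½ ½)) (ℚₚ.*-identityʳ ε)

    m≤ : ∀ {m n k} → m ℕ.⊔ n ≤ k → m ≤ k
    m≤ = ℕₚ.≤-trans (ℕₚ.m≤m⊔n _ _)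

    n≤ : ∀ {m n k} → m ℕ.⊔ n ≤ k → n ≤ k
    n≤ {m} = ℕₚ.≤-trans (ℕₚ.m≤n⊔m m _)

  abstract
    Close-sym : ∀ f g → Close f g → Close g f
    Close-sym f g c ε 0<ε with c ε 0<ε
    ... | N , p = N , λ {m} {n} N≤m N≤n →
      subst (ℚ._< ε) (∣p-q∣≡∣q-p∣ (f n) (g m)) (p N≤n N≤m)

    Close-trans : ∀ f g h → Close f g → Close g h → Close f h
    Close-trans f g h c d ε 0<ε with c _ (half>0 0<ε) | d _ (half>0 0<ε)
    ... | N , p | N′ , p′ = N ℕ.⊔ N′ , λ {m} {n} N≤m N≤n → begin-strict
      ∣ f m ℚ.- h n ∣
        ≤⟨ triangle (f m) (g n) (h n) ⟩
      ∣ f m ℚ.- g n ∣ ℚ.+ ∣ g n ℚ.- h n ∣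
        <⟨ ℚₚ.+-mono-< (p (m≤ N≤m) (m≤ N≤n)) (p′ (n≤ {N} N≤n) (n≤ {N} N≤n)) ⟩
      ε ℚ.* ½ ℚ.+ ε ℚ.* ½
        ≡⟨ half+half ε ⟩
      ε ∎
      where open ℚₚ.≤-Reasoning

    Close-resp-≗ : ∀ f g h → (∀ n → g n ≡ h n) → Close f g → Close f h
    Close-resp-≗ f g h g≗h c ε 0<ε with c ε 0<ε
    ... | N , p = N , λ {m} {n} N≤m N≤n →
      subst (λ q → ∣ f m ℚ.- q ∣ ℚ.< ε) (g≗h n) (p N≤m N≤n)

    Close-const : ∀ q → Close (λ _ → q) (λ _ → q)
    Close-const q ε 0<ε = 0 , λ _ _ →
      subst (ℚ._< ε) (sym (cong ∣_∣ (ℚₚ.+-inverseʳ q))) 0<ε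

    Close-neg : ∀ f g → Close f g → Close (λ n → ℚ.- f n) (λ n → ℚ.- g n)
    Close-neg f g c ε 0<ε with c ε 0<ε
    ... | N , p = N , λ {m} {n} N≤m N≤n →
      subst (ℚ._< ε)
        (trans (∣p-q∣≡∣q-p∣ (f m) (g n))
               (cong ∣_∣ (solve 2 (λ p q → q :- p := :- p :- (:- q)) refl (f m) (g n))))
        (p N≤m N≤n)

    Close-+ : ∀ f g f′ g′ → Close f g → Close f′ g′ →
              Close (λ n → f n ℚ.+ f′ n) (λ n → g n ℚ.+ g′ n)
    Close-+ f g f′ g′ c d ε 0<ε with c _ (half>0 0<ε) | d _ (half>0 0<ε)
    ... | N , p | N′ , p′ = N ℕ.⊔ N′ , λ {m} {n} N≤m N≤n → begin-strict
      ∣ (f m ℚ.+ f′ m) ℚ.- (g n ℚ.+ g′ n) ∣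
        ≡⟨ cong ∣_∣ (solve 4 (λ a b c d → (a :+ b) :- (c :+ d) := (a :- c) :+ (b :- d))
                           refl (f m) (f′ m) (g n) (g′ n)) ⟩
      ∣ (f m ℚ.- g n) ℚ.+ (f′ m ℚ.- g′ n) ∣
        ≤⟨ ℚₚ.∣p+q∣≤∣p∣+∣q∣ (f m ℚ.- g n) (f′ m ℚ.- g′ n) ⟩
      ∣ f m ℚ.- g n ∣ ℚ.+ ∣ f′ m ℚ.- g′ n ∣
        <⟨ ℚₚ.+-mono-< (p (m≤ N≤m) (m≤ N≤n)) (p′ (n≤ {N} N≤m) (n≤ {N} N≤n)) ⟩
      ε ℚ.* ½ ℚ.+ ε ℚ.* ½
        ≡⟨ half+half ε ⟩
      ε ∎
      where open ℚₚ.≤-Reasoning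

    private
      bounded : ∀ f g → Close f g →
                ∃₂ λ K N → 0ℚ ℚ.< K × (∀ {m} → N ≤ m → ∣ f m ∣ ℚ.≤ K)
      bounded f g c with c 1ℚ (ℚₚ.positive⁻¹ 1ℚ)
      ... | N , p = 1ℚ ℚ.+ ∣ g N ∣ , N , 0<K , bound
        where
        open ℚₚ.≤-Reasoning
        0<K : 0ℚ ℚ.< 1ℚ ℚ.+ ∣ g N ∣
        0<K = ℚₚ.+-mono-<-≤ (ℚₚ.positive⁻¹ 1ℚ) (ℚₚ.0≤∣p∣ (g N))
        bound : ∀ {m} → N ≤ m → ∣ f m ∣ ℚ.≤ 1ℚ ℚ.+ ∣ g N ∣
        bound {m} N≤m = begin
          ∣ f m ∣
            ≡⟨ cong ∣_∣ (solve 2 (λ a b → a := (a :- b) :+ b) refl (f m) (g N)) ⟩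
          ∣ (f m ℚ.- g N) ℚ.+ g N ∣
            ≤⟨ ℚₚ.∣p+q∣≤∣p∣+∣q∣ (f m ℚ.- g N) (g N) ⟩
          ∣ f m ℚ.- g N ∣ ℚ.+ ∣ g N ∣
            ≤⟨ ℚₚ.+-monoˡ-≤ ∣ g N ∣ (ℚₚ.<⇒≤ (p N≤m ℕₚ.≤-refl)) ⟩
          1ℚ ℚ.+ ∣ g N ∣ ∎

      scaled : ∀ {K δ} x y → 0ℚ ℚ.< K → ∣ x ∣ ℚ.≤ K → ∣ y ∣ ℚ.< δ →
               ∣ x ℚ.* y ∣ ℚ.< K ℚ.* δ
      scaled {K} {δ} x y 0<K x≤K y<δ = begin-strict
        ∣ x ℚ.* y ∣       ≡⟨ ℚₚ.∣p*q∣≡∣p∣*∣q∣ x y ⟩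
        ∣ x ∣ ℚ.* ∣ y ∣   ≤⟨ ℚₚ.*-monoʳ-≤-nonNeg ∣ y ∣ {{ℚₚ.∣-∣-nonNeg y}} x≤K ⟩
        K ℚ.* ∣ y ∣       <⟨ ℚₚ.*-monoʳ-<-pos K {{ℚ.positive 0<K}} y<δ ⟩
        K ℚ.* δ           ∎
        where open ℚₚ.≤-Reasoning

      quotient : ∀ C ε → 0ℚ ℚ.< C → 0ℚ ℚ.< ε → ∃ λ δ → 0ℚ ℚ.< δ × C ℚ.* δ ≡ ε
      quotient C ε 0<C 0<ε = δ , 0<δ , eq
        where
        instance
          C⁺ : ℚ.Positive C
          C⁺ = ℚ.positive 0<C
          C≢0 : ℚ.NonZero C
          C≢0 = ℚₚ.pos⇒nonZero C
          ε⁺ : ℚ.Positive ε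
          ε⁺ = ℚ.positive 0<ε
        δ : ℚ
        δ = (ℚ.1/ C) ℚ.* ε
        0<δ : 0ℚ ℚ.< δ
        0<δ = ℚₚ.positive⁻¹ δ {{ℚₚ.pos*pos⇒pos (ℚ.1/ C) {{ℚₚ.1/pos⇒pos C}} ε}}
        eq : C ℚ.* δ ≡ ε
        eq = trans (sym (ℚₚ.*-assoc C (ℚ.1/ C) ε))
          (trans (cong (ℚ._* ε) (ℚₚ.*-inverseʳ C)) (ℚₚ.*-identityˡ ε))

      product-bound : ∀ {K K′ δ} x x′ y y′ → 0ℚ ℚ.< K → 0ℚ ℚ.< K′ →
                      ∣ x ∣ ℚ.≤ K → ∣ y′ ∣ ℚ.≤ K′ →
                      ∣ x ℚ.- y ∣ ℚ.< δ → ∣ x′ ℚ.- y′ ∣ ℚ.< δ →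
                      ∣ x ℚ.* x′ ℚ.- y ℚ.* y′ ∣ ℚ.< (K ℚ.+ K′) ℚ.* δ
      product-bound {K} {K′} {δ} x x′ y y′ 0<K 0<K′ x≤K y′≤K′ x-y<δ x′-y′<δ = begin-strict
        ∣ x ℚ.* x′ ℚ.- y ℚ.* y′ ∣
          ≤⟨ triangle (x ℚ.* x′) (x ℚ.* y′) (y ℚ.* y′) ⟩
        ∣ x ℚ.* x′ ℚ.- x ℚ.* y′ ∣ ℚ.+ ∣ x ℚ.* y′ ℚ.- y ℚ.* y′ ∣
          ≡⟨ cong₂ (λ p q → ∣ p ∣ ℚ.+ ∣ q ∣) (sym (x[y-z]≈xy-xz x x′ y′))
               (trans (sym ([y-z]x≈yx-zx y′ x y)) (ℚₚ.*-comm (x ℚ.- y) y′)) ⟩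
        ∣ x ℚ.* (x′ ℚ.- y′) ∣ ℚ.+ ∣ y′ ℚ.* (x ℚ.- y) ∣
          <⟨ ℚₚ.+-mono-< (scaled x (x′ ℚ.- y′) 0<K x≤K x′-y′<δ)
                         (scaled y′ (x ℚ.- y) 0<K′ y′≤K′ x-y<δ) ⟩
        K ℚ.* δ ℚ.+ K′ ℚ.* δ
          ≡⟨ sym (ℚₚ.*-distribʳ-+ δ K K′) ⟩
        (K ℚ.+ K′) ℚ.* δ ∎
        where open ℚₚ.≤-Reasoning

    Close-* : ∀ f g f′ g′ → Close f g → Close f′ g′ →
              Close (λ n → f n ℚ.* f′ n) (λ n → g n ℚ.* g′ n)
    Close-* f g f′ g′ c d ε 0<ε =
      let K  , L  , 0<K  , f≤K   = bounded f g c
          K′ , L′ , 0<K′ , g′≤K′ = bounded g′ f′ (Close-sym f′ g′ d)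
          δ  , 0<δ , [K+K′]δ≡ε   = quotient (K ℚ.+ K′) ε (ℚₚ.+-mono-< 0<K 0<K′) 0<ε
          N  , p                 = c δ 0<δ
          N′ , p′                = d δ 0<δ
      in (L ℕ.⊔ L′) ℕ.⊔ (N ℕ.⊔ N′) , λ {m} {n} ≤m ≤n →
        subst (∣ f m ℚ.* f′ m ℚ.- g n ℚ.* g′ n ∣ ℚ.<_) [K+K′]δ≡ε
          (product-bound (f m) (f′ m) (g n) (g′ n) 0<K 0<K′
            (f≤K (m≤ {L} {L′} (m≤ ≤m))) (g′≤K′ (n≤ {L} {L′} (m≤ ≤n)))
            (p (m≤ {N} {N′} (n≤ {L ℕ.⊔ L′} ≤m)) (m≤ {N} {N′} (n≤ {L ℕ.⊔ L′} ≤n)))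
            (p′ (n≤ {N} {N′} (n≤ {L ℕ.⊔ L′} ≤m)) (n≤ {N} {N′} (n≤ {L ℕ.⊔ L′} ≤n))))

fromℚ : ℚ → ℝ
fromℚ q = mkℝ (λ _ → q) (Close-const q)

infixl 6 _+ᴿ_
infixl 7 _*ᴿ_
infix  8 -ᴿ_

_+ᴿ_ _*ᴿ_ : ℝ → ℝ → ℝ
x +ᴿ y = mkℝ (λ n → seq x n ℚ.+ seq y n) (Close-+ (seq x) (seq x) (seq y) (seq y) (cauchy x) (cauchy y))
x *ᴿ y = mkℝ (λ n → seq x n ℚ.* seq y n) (Close-* (seq x) (seq x) (seq y) (seq y) (cauchy x) (cauchy y))

-ᴿ_ : ℝ → ℝ
-ᴿ x = mkℝ (λ n → ℚ.- seq x n) (Close-neg (seq x) (seq x) (cauchy x))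

≗⇒≃ : ∀ x y → (∀ n → seq x n ≡ seq y n) → x ≃ y
≗⇒≃ x y eq = mk≃ (Close-resp-≗ (seq x) (seq x) (seq y) eq (cauchy x))

≃-refl : ∀ {x} → x ≃ x
≃-refl {x} = mk≃ (cauchy x)

≃-sym : ∀ {x y} → x ≃ y → y ≃ x
≃-sym {x} {y} (mk≃ x≃y) = mk≃ (Close-sym (seq x) (seq y) x≃y)

≃-trans : ∀ {x y z} → x ≃ y → y ≃ z → x ≃ z
≃-trans {x} {y} {z} (mk≃ x≃y) (mk≃ y≃z) =
  mk≃ (Close-trans (seq x) (seq y) (seq z) x≃y y≃z)

+ᴿ-cong : ∀ {x y z w} → x ≃ y → z ≃ w → x +ᴿ z ≃ y +ᴿ w
+ᴿ-cong {x} {y} {z} {w} (mk≃ x≃y) (mk≃ z≃w) =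
  mk≃ (Close-+ (seq x) (seq y) (seq z) (seq w) x≃y z≃w)

*ᴿ-cong : ∀ {x y z w} → x ≃ y → z ≃ w → x *ᴿ z ≃ y *ᴿ w
*ᴿ-cong {x} {y} {z} {w} (mk≃ x≃y) (mk≃ z≃w) =
  mk≃ (Close-* (seq x) (seq y) (seq z) (seq w) x≃y z≃w)

-ᴿ-cong : ∀ {x y} → x ≃ y → -ᴿ x ≃ -ᴿ y
-ᴿ-cong {x} {y} (mk≃ x≃y) = mk≃ (Close-neg (seq x) (seq y) x≃y)

+ᴿ-assoc : ∀ x y z → (x +ᴿ y) +ᴿ z ≃ x +ᴿ (y +ᴿ z)
+ᴿ-assoc x y z = ≗⇒≃ _ _ λ n → ℚₚ.+-assoc (seq x n) (seq y n) (seq z n)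

+ᴿ-comm : ∀ x y → x +ᴿ y ≃ y +ᴿ x
+ᴿ-comm x y = ≗⇒≃ _ _ λ n → ℚₚ.+-comm (seq x n) (seq y n)

+ᴿ-identityˡ : ∀ x → fromℚ 0ℚ +ᴿ x ≃ x
+ᴿ-identityˡ x = ≗⇒≃ _ _ λ n → ℚₚ.+-identityˡ (seq x n)

+ᴿ-inverseˡ : ∀ x → -ᴿ x +ᴿ x ≃ fromℚ 0ℚ
+ᴿ-inverseˡ x = ≗⇒≃ _ _ λ n → ℚₚ.+-inverseˡ (seq x n)

*ᴿ-assoc : ∀ x y z → (x *ᴿ y) *ᴿ z ≃ x *ᴿ (y *ᴿ z)
*ᴿ-assoc x y z = ≗⇒≃ _ _ λ n → ℚₚ.*-assoc (seq x n) (seq y n) (seq z n)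

*ᴿ-comm : ∀ x y → x *ᴿ y ≃ y *ᴿ x
*ᴿ-comm x y = ≗⇒≃ _ _ λ n → ℚₚ.*-comm (seq x n) (seq y n)

*ᴿ-identityˡ : ∀ x → fromℚ 1ℚ *ᴿ x ≃ x
*ᴿ-identityˡ x = ≗⇒≃ _ _ λ n → ℚₚ.*-identityˡ (seq x n)

*ᴿ-distribˡ-+ᴿ : ∀ x y z → x *ᴿ (y +ᴿ z) ≃ x *ᴿ y +ᴿ x *ᴿ z
*ᴿ-distribˡ-+ᴿ x y z = ≗⇒≃ _ _ λ n → ℚₚ.*-distribˡ-+ (seq x n) (seq y n) (seq z n)

ℝ-setoid : Setoid 0ℓ 0ℓ
ℝ-setoid = record
  { Carrier       = ℝ
  ; _≈_           = _≃_
  ; isEquivalence = record { refl = ≃-refl ; sym = ≃-sym ; trans = ≃-trans }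
  }

ℝ-commutativeRing : CommutativeRing 0ℓ 0ℓ
ℝ-commutativeRing = record
  { Carrier = ℝ
  ; _≈_     = _≃_
  ; _+_     = _+ᴿ_
  ; _*_     = _*ᴿ_
  ; -_      = -ᴿ_
  ; 0#      = fromℚ 0ℚ
  ; 1#      = fromℚ 1ℚ
  ; isCommutativeRing = record
    { isRing = record
      { +-isAbelianGroup = record
        { isGroup = record
          { isMonoid = record
            { isSemigroup = record
              { isMagma = record
                { isEquivalence = Setoid.isEquivalence ℝ-setoid
                ; ∙-cong        = +ᴿ-cong
                }
              ; assoc = +ᴿ-assoc
              }
            ; identity = comm∧idˡ⇒id +ᴿ-comm +ᴿ-identityˡ
            }
          ; inverse = comm∧invˡ⇒inv +ᴿ-comm +ᴿ-inverseˡ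
          ; ⁻¹-cong = -ᴿ-cong
          }
        ; comm = +ᴿ-comm
        }
      ; *-cong     = *ᴿ-cong
      ; *-assoc    = *ᴿ-assoc
      ; *-identity = comm∧idˡ⇒id *ᴿ-comm *ᴿ-identityˡ
      ; distrib    = comm∧distrˡ⇒distr +ᴿ-cong *ᴿ-comm *ᴿ-distribˡ-+ᴿ
      }
    ; *-comm = *ᴿ-comm
    }
  }
  where open import Algebra.Consequences.Setoid ℝ-setoid

module ℝᶜ = CommutativeRing ℝ-commutativeRing

0ᴿ : ℝ
0ᴿ = ℝᶜ.0#

∑ : ∀ {n} → Vector ℝ n → ℝ
∑ = RawMonoidOps.sum ℝᶜ.+-rawMonoid

infix 4 _≋_
_≋_ : ∀ {n} → Rel (Vector ℝ n) 0ℓ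
v ≋ w = ∀ i → v i ≃ w i

𝟎 : ∀ {n} → Vector ℝ n
𝟎 _ = 0ᴿ

Matrix : ℕ → Set
Matrix N = Fin N → Fin N → ℝ

_·_ : ∀ {N} → Matrix N → Vector ℝ N → Vector ℝ N
(A · v) i = ∑ λ j → A i j *ᴿ v j

Kernel : ∀ {N} → Matrix N → Pred (Vector ℝ N) 0ℓ
Kernel A v = A · v ≋ 𝟎

combination : ∀ {N k} → (Fin k → Vector ℝ N) → Vector ℝ k → Vector ℝ N
combination b c i = ∑ λ j → c j *ᴿ b j i

LinearlyIndependent : ∀ {N k} → (Fin k → Vector ℝ N) → Set
LinearlyIndependent b = ∀ c → combination b c ≋ 𝟎 → c ≋ 𝟎

record IsBasis {N k} (P : Pred (Vector ℝ N) 0ℓ) (b : Fin k → Vector ℝ N) : Set where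
  field
    inside      : ∀ j → P (b j)
    independent : LinearlyIndependent b
    spanning    : ∀ v → P v → ∃ λ c → v ≋ combination b c

-- A relation rather than a function: without deciding equality of reals
-- the rank of a matrix is not computable.
HasNullity : ∀ {N} → Matrix N → ℕ → Set
HasNullity {N} A k = ∃ λ (b : Fin k → Vector ℝ N) → IsBasis (Kernel A) b

record SimpleGraph {v ℓ} (V : Setoid v ℓ) e : Set (v ⊔ ℓ ⊔ lsuc e) where
  open Setoid V using (Carrier; _≈_)
  field
    Adjacent     : Rel Carrier e
    resp-≈       : Adjacent Respects₂ _≈_
    symmetric    : Symmetric Adjacent
    irreflexive  : ∀ {x y} → x ≈ y → ¬ Adjacent x y

-- A listing of V without repetition: in particular V has N elements.
Enumeration : ∀ {v ℓ} → ℕ → Setoid v ℓ → Set (v ⊔ ℓ)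
Enumeration N V = Inverse (≡ₚ.setoid (Fin N)) V

module _ {v ℓ e N} {V : Setoid v ℓ} (u : Enumeration N V) (Γ : SimpleGraph V e) where
  open SimpleGraph Γ

  -- Membership in S(Γ), with rows and columns indexed through u.
  record Pattern (A : Matrix N) : Set e where
    field
      symmetricMatrix : ∀ i j → A i j ≃ A j i
      nonzero⇔adjacent : ∀ {i j} → i ≢ j →
        (¬ A i j ≃ 0ᴿ) ⇔ Adjacent (Inverse.to u i) (Inverse.to u j)

  record IsMaximumNullity (M : ℕ) : Set e where
    field
      attained   : ∃ λ A → Pattern A × HasNullity A M
      upperBound : ∀ A k → Pattern A → HasNullity A k → k ≤ M

record ConnectionSet {c ℓ} (G : Group c ℓ) s : Set (c ⊔ ℓ ⊔ lsuc s) where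
  open Group G
  field
    member         : Pred Carrier s
    resp-≈         : member Respects _≈_
    inverseClosed  : ∀ {g} → member g → member (g ⁻¹)
    identityFree   : ¬ member ε

cayleyGraph : ∀ {c ℓ s} (G : Group c ℓ) → ConnectionSet G s →
              SimpleGraph (Group.setoid G) s
cayleyGraph G S = record
  { Adjacent    = λ g h → member (g ∙ h ⁻¹)
  ; resp-≈      = (λ h≈h′ → resp (∙-congˡ (⁻¹-cong h≈h′)))
                , (λ g≈g′ → resp (∙-congʳ g≈g′))
  ; symmetric   = λ {g} {h} gh⁻¹∈S → resp (⁻¹-anti-homo-// g h) (inverseClosed gh⁻¹∈S)
  ; irreflexive = λ g≈h gh⁻¹∈S → identityFree (resp (x≈y⇒x∙y⁻¹≈ε g≈h) gh⁻¹∈S)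
  }
  where
  open Group G
  open GroupProperties G
  open ConnectionSet S renaming (resp-≈ to resp)

B : ℕ → ℕ → Pred ℕ 0ℓ
B d n t = 1 ≤ t × t ≤ n × gcd t n ≡ d

range : ℕ → List ℕ
range n = map suc (upTo n)

φ : ℕ → ℕ
φ n = length (filter (λ t → gcd t n ℕₚ.≟ 1) (range n))

divisors : ℕ → List ℕ
divisors n = filter (_∣? n) (range n)

DivisibleByPrimeSquare : Pred ℕ 0ℓ
DivisibleByPrimeSquare x = ∃ λ p → Prime p × p ℕ.^ 2 ∣ x

divisibleByPrimeSquare? : Decidable DivisibleByPrimeSquare
divisibleByPrimeSquare? zero = yes (2 , prime[2] , 4 ∣0)
divisibleByPrimeSquare? x@(suc _) = map′
  (λ (p , _ , h) → p , h)
  (λ (p , pr , p²∣x) → p , s≤s (∣⇒≤ (∣-trans (m∣m*n (p ℕ.^ 1)) p²∣x)) , pr , p²∣x)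
  (ℕₚ.anyUpTo? (λ p → prime? p ×-dec (p ℕ.^ 2 ∣? x)) (suc x))

SquareFree : Pred ℕ 0ℓ
SquareFree n = ¬ DivisibleByPrimeSquare n

X : ℕ → List ℕ
X n = filter divisibleByPrimeSquare? (divisors n)

∑φ : List ℕ → ℕ
∑φ xs = sum (map φ xs)

module _ {c ℓ} (G : Group c ℓ) where
  open Group G

  infixr 8 _^ᴺ_ _^ᶻ_

  _^ᴺ_ : Carrier → ℕ → Carrier
  a ^ᴺ k = RawMonoidOps._×_ rawMonoid k a

  _^ᶻ_ : Carrier → ℤ → Carrier
  a ^ᶻ (ℤ.+ k)    = a ^ᴺ k
  a ^ᶻ ℤ.-[1+ k ] = (a ^ᴺ suc k) ⁻¹

  Generates : Carrier → Set (c ⊔ ℓ)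
  Generates a = ∀ g → ∃ λ k → g ≈ a ^ᶻ k

module _ {c ℓ} (G : Group c ℓ) (n : ℕ) (2≤n : 2 ≤ n)
         (u : Enumeration n (Group.setoid G))
         (a : Group.Carrier G) (gen : Generates G a) where
  open Group G renaming (refl to ≈-refl; sym to ≈-sym; trans to ≈-trans)
  open GroupProperties G using (inverseˡ-unique; inverseʳ-unique; ∙-cancelˡ)
  open MonoidMult monoid using (×-homo-+; ×-assocˡ; ×-congˡ; ×-congʳ)
  open Inverse u using (to; from; from-cong; strictlyInverseˡ; strictlyInverseʳ)
  open import Relation.Binary.Reasoning.Setoid setoid

  private
    infixr 8 _^_
    _^_ : Carrier → ℕ → Carrier
    _^_ = _^ᴺ_ G

    ^-+ : ∀ m k → a ^ (m ℕ.+ k) ≈ a ^ m ∙ a ^ k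
    ^-+ = ×-homo-+ a

    ε^ : ∀ m → ε ^ m ≈ ε
    ε^ zero    = ≈-refl
    ε^ (suc m) = ≈-trans (identityˡ _) (ε^ m)

    ^-*ε : ∀ m k → a ^ k ≈ ε → a ^ (m ℕ.* k) ≈ ε
    ^-*ε m k aᵏ≈ε = begin
      a ^ (m ℕ.* k)  ≈⟨ ×-assocˡ a m k ⟨
      (a ^ k) ^ m    ≈⟨ ×-congʳ m aᵏ≈ε ⟩
      ε ^ m          ≈⟨ ε^ m ⟩
      ε              ∎

    naturalExponent : ∀ k → a ^ suc k ≈ ε → ∀ g → ∃ λ r → g ≈ a ^ r
    naturalExponent k aᵏ≈ε g with gen g
    ... | ℤ.+ z , g≈ = z , g≈
    ... | ℤ.-[1+ z ] , g≈ = k ℕ.* suc z , ≈-trans g≈ (≈-sym (inverseʳ-unique _ _ (begin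
      a ^ suc z ∙ a ^ (k ℕ.* suc z)   ≈⟨ ^-+ (suc z) (k ℕ.* suc z) ⟨
      a ^ (suc k ℕ.* suc z)           ≈⟨ ×-congˡ (ℕₚ.*-comm (suc k) (suc z)) ⟩
      a ^ (suc z ℕ.* suc k)           ≈⟨ ^-*ε (suc z) (suc k) aᵏ≈ε ⟩
      ε                               ∎)))

    smallExponent : ∀ k → a ^ suc k ≈ ε → ∀ g → ∃ λ (r : Fin (suc k)) → g ≈ a ^ toℕ r
    smallExponent k aᵏ≈ε g with naturalExponent k aᵏ≈ε g
    ... | r , g≈ = fromℕ< (m%n<n r (suc k)) , (begin
      g                                                   ≈⟨ g≈ ⟩
      a ^ r
        ≈⟨ ×-congˡ (m≡m%n+[m/n]*n r (suc k)) ⟩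
      a ^ (r % suc k ℕ.+ (r / suc k) ℕ.* suc k)
        ≈⟨ ^-+ (r % suc k) ((r / suc k) ℕ.* suc k) ⟩
      a ^ (r % suc k) ∙ a ^ ((r / suc k) ℕ.* suc k)
        ≈⟨ ∙-congˡ (^-*ε (r / suc k) (suc k) aᵏ≈ε) ⟩
      a ^ (r % suc k) ∙ ε
        ≈⟨ identityʳ _ ⟩
      a ^ (r % suc k)
        ≈⟨ ×-congˡ (sym (Finₚ.toℕ-fromℕ< (m%n<n r (suc k)))) ⟩
      a ^ toℕ (fromℕ< (m%n<n r (suc k)))                  ∎)

  a^k≈ε⇒n≤k : ∀ k → 1 ≤ k → a ^ k ≈ ε → n ≤ k
  a^k≈ε⇒n≤k (suc k) _ aᵏ≈ε = ℕₚ.≮⇒≥ λ k<n → collide (Finₚ.pigeonhole k<n exponent)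
    where
    exponent : Fin n → Fin (suc k)
    exponent i = proj₁ (smallExponent k aᵏ≈ε (to i))
    collide : (∃₂ λ i j → i Fin.< j × exponent i ≡ exponent j) → ⊥
    collide (i , j , i<j , eq) = Finₚ.<⇒≢ i<j
      (trans (sym (strictlyInverseʳ i)) (trans (from-cong toi≈toj) (strictlyInverseʳ j)))
      where
      toi≈toj : to i ≈ to j
      toi≈toj = begin
        to i                    ≈⟨ proj₂ (smallExponent k aᵏ≈ε (to i)) ⟩
        a ^ toℕ (exponent i)    ≈⟨ ×-congˡ (cong toℕ eq) ⟩
        a ^ toℕ (exponent j)    ≈⟨ proj₂ (smallExponent k aᵏ≈ε (to j)) ⟨
        to j                    ∎

  a^n≈ε : a ^ n ≈ ε
  a^n≈ε = collide (Finₚ.pigeonhole (ℕₚ.n<1+n n) (λ i → from (a ^ toℕ i)))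
    where
    collide : (∃₂ λ i j → i Fin.< j × from (a ^ toℕ i) ≡ from (a ^ toℕ j)) → a ^ n ≈ ε
    collide (i , j , i<j , eq) =
      subst (λ m → a ^ m ≈ ε) (ℕₚ.≤-antisym k≤n (a^k≈ε⇒n≤k k 1≤k aᵏ≈ε)) aᵏ≈ε
      where
      k : ℕ
      k = toℕ j ∸ toℕ i
      1≤k : 1 ≤ k
      1≤k = ℕₚ.m<n⇒0<n∸m i<j
      k≤n : k ≤ n
      k≤n = ℕₚ.≤-trans (ℕₚ.m∸n≤m (toℕ j) (toℕ i)) (ℕₚ.≤-pred (Finₚ.toℕ<n j))
      aᵏ≈ε : a ^ k ≈ ε
      aᵏ≈ε = ∙-cancelˡ (a ^ toℕ i) (a ^ k) ε (begin
        a ^ toℕ i ∙ a ^ k             ≈⟨ ^-+ (toℕ i) k ⟨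
        a ^ (toℕ i ℕ.+ k)             ≈⟨ ×-congˡ (ℕₚ.m+[n∸m]≡n (ℕₚ.<⇒≤ i<j)) ⟩
        a ^ toℕ j                     ≈⟨ strictlyInverseˡ _ ⟨
        to (from (a ^ toℕ j))         ≡⟨ cong to eq ⟨
        to (from (a ^ toℕ i))         ≈⟨ strictlyInverseˡ _ ⟩
        a ^ toℕ i                     ≈⟨ identityʳ _ ⟨
        a ^ toℕ i ∙ ε                 ∎)

  private
    n∉B : ¬ B 1 n n
    n∉B (_ , _ , gcd≡1) with gcd≡1⇒coprime {n} {n} gcd≡1 (∣-refl , ∣-refl)
    ... | refl = contradiction 2≤n λ { (s≤s ()) }

    B-reflect : ∀ {t} → B 1 n t → B 1 n (n ∸ t)
    B-reflect {t} t∈B@(_ , t≤n , gcd≡1) =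
      ℕₚ.m<n⇒0<n∸m (ℕₚ.≤∧≢⇒< t≤n λ { refl → n∉B t∈B }) , ℕₚ.m∸n≤m n t ,
      coprime⇒gcd≡1 {n ∸ t} {n} λ { {d} (d∣n∸t , d∣n) → gcd≡1⇒coprime {t} {n} gcd≡1
        (∣m+n∣m⇒∣n {m = n ∸ t} (subst (d ∣_) (sym (ℕₚ.m∸n+n≡m t≤n)) d∣n) d∣n∸t , d∣n) }

  unitPowers : ConnectionSet G ℓ
  unitPowers = record
    { member        = λ g → ∃ λ i → B 1 n i × g ≈ a ^ i
    ; resp-≈        = λ { g≈h (i , i∈B , g≈) → i , i∈B , ≈-trans (≈-sym g≈h) g≈ }
    ; inverseClosed = λ { {g} (i , i∈B@(_ , i≤n , _) , g≈) → n ∸ i , B-reflect i∈B ,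
        ≈-sym (inverseˡ-unique _ _ (begin
          a ^ (n ∸ i) ∙ g           ≈⟨ ∙-congˡ g≈ ⟩
          a ^ (n ∸ i) ∙ a ^ i       ≈⟨ ^-+ (n ∸ i) i ⟨
          a ^ (n ∸ i ℕ.+ i)         ≈⟨ ×-congˡ (ℕₚ.m∸n+n≡m i≤n) ⟩
          a ^ n                     ≈⟨ a^n≈ε ⟩
          ε                         ∎)) }
    ; identityFree  = λ { (i , i∈B@(1≤i , i≤n , _) , ε≈) →
        n∉B (subst (B 1 n) (ℕₚ.≤-antisym i≤n (a^k≈ε⇒n≤k i 1≤i (≈-sym ε≈))) i∈B) }
    }

{-# OPTIONS --safe #-}
module Submission where

-- Up to relabelling, the matrices are indexed by exponents i, j < n, and i, j are adjacent iff
-- i ≢ j modulo every prime p ∣ n; so the adjacency matrix is ∏ₚ (1 - [i ≡ j mod p]).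
-- Its columns depend only on j modulo the radical m of n, hence its nullity is at least n - m,
-- and sorting 1, …, n by gcd with n gives n - m ≥ ∑ φ(x) over x ∈ X.
-- For square-free n subtract ∏ₚ (-[i ≡ j mod p]), which is a multiple of the identity: the
-- result kills v_x(y) = ∏ₚ ([y ≡ x mod p] - [y ≡ 0 mod p]) for every unit x, and these φ(n)
-- vectors restrict to the standard basis on the units. Finally φ(d) ≤ φ(n) for d ∣ n.
open import Defs
open import Algebra.Bundles using (Group)
import Algebra.Properties.CommutativeMonoid.Sum as CommutativeMonoidSum
import Algebra.Properties.Group as GroupProperties
import Algebra.Properties.Monoid.Mult as MonoidMult
import Algebra.Properties.Semiring.Sum as SemiringSum
open import Data.Empty using (⊥)
open import Data.Fin.Base using (Fin; zero; suc; toℕ; fromℕ; fromℕ<; inject₁)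
open import Data.Fin.Permutation as Permutation using (Permutation; permutation; _⟨$⟩ʳ_; _⟨$⟩ˡ_)
import Data.Fin.Properties as Finₚ
open import Data.Integer.Base as ℤ using ()
open import Data.List.Base using (List; []; _∷_; _++_; concatMap; filter; length; lookup; map; upTo)
open import Data.List.Properties using (length-++; length-map; length-upTo)
open import Data.List.Membership.Propositional using (_∈_)
open import Data.List.Membership.Propositional.Properties
  using (∈-++⁻; ∈-filter⁺; ∈-filter⁻; ∈-lookup; ∈-map⁺; ∈-map⁻; ∈-upTo⁺; ∈-upTo⁻)
import Data.List.Membership.Setoid.Properties as Membershipₚ
open import Data.List.Relation.Unary.All as All using (All; []; _∷_)
import Data.List.Relation.Unary.All.Properties as Allₚ
open import Data.List.Relation.Unary.AllPairs using ([]; _∷_)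
open import Data.List.Relation.Unary.Any as Any using (Any; here; there)
open import Data.List.Relation.Unary.Unique.Propositional using (Unique)
import Data.List.Relation.Unary.Unique.Propositional.Properties as Uniqueₚ
open import Data.Nat.Base as ℕ
  using (ℕ; zero; suc; NonZero; _+_; _*_; _∸_; _⊔_; _≤_; _<_; _≥_; z≤n; s≤s)
open import Data.Nat.Coprimality as Coprime
  using (Coprime; coprime-divisor; coprime⇒gcd≡1; gcd≡1⇒coprime)
open import Data.Nat.Divisibility
open import Data.Nat.DivMod
open import Data.Nat.GCD
  using (c*gcd[m,n]≡gcd[cm,cn]; gcd; gcd-greatest; gcd[m,n]≢0; module Bézout)
open import Data.Nat.Induction using (<-rec)
open import Data.Nat.ListAction using (product; sum)
open import Data.Nat.ListAction.Properties using (∈⇒∣product)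
open import Data.Nat.Primality
open import Data.Nat.Primality.Factorisation
import Data.Nat.Properties as ℕₚ
open import Data.Nat.Tactic.RingSolver using (solve-∀)
open import Data.Product.Base using (∃; _×_; _,_; proj₁; proj₂)
open import Data.Rational.Base as ℚ using (ℚ; 0ℚ; 1ℚ; ½; ∣_∣)
import Data.Rational.Properties as ℚₚ
import Data.Rational.Solver as ℚSolver
open import Data.Sum.Base using (inj₁; inj₂)
open import Data.Vec.Functional using (Vector; removeAt) renaming (_∷_ to _∷ᵛ_)
open import Function.Base using (_∘_; case_of_)
open import Function.Bundles using (_⇔_; Equivalence; Inverse; mk⇔)
open import Relation.Binary.Bundles using (Setoid)
open import Relation.Binary.PropositionalEquality
  using (_≡_; _≢_; refl; sym; trans; cong; cong₂; subst; module ≡-Reasoning)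
import Relation.Binary.PropositionalEquality.Properties as ≡ₚ
import Relation.Binary.Reasoning.Setoid as SetoidReasoning
open import Relation.Nullary.Decidable using (decidable-stable; yes; no)
open import Relation.Nullary.Negation using (¬_; contradiction)

open CommutativeMonoidSum ℝᶜ.+-commutativeMonoid
  using (sum-cong-≋; sum-init-last; sum-permute; sum-remove; sum-replicate-zero; ∑-distrib-+)
open SemiringSum ℝᶜ.semiring using (*-distribˡ-sum)
open ℚSolver.+-*-Solver using (_:=_; _:+_; _:*_; _:-_; :-_; con) renaming (solve to ℚ-solve)
module ≃-Reasoning = SetoidReasoning ℝ-setoid

-- Inverses of real numbers

-- The matrix subtracted for square-free `n` is μ(n) times the identity, and μ(n) is the eigenvalue
-- of the adjacency matrix on the characters that are nontrivial modulo every prime p ∣ n. There are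
-- ∏ₚ (p - 1) = φ(n) of these; the vectors v_x are a rational basis of the same eigenspace, which
-- keeps the argument away from complex numbers. The other obstacle is constructive:
-- `IsMaximumNullity` bounds only exact nullities, so independent kernel vectors alone say nothing
-- about `M`, and completing them to a basis of the kernel would require deciding which reals
-- vanish. Kernel vectors are therefore kept in echelon form, where independence and the bound by
-- `N` are read off the pivots. They are completed to a basis under a double negation, which the
-- decidability of `_≤_` on ℕ removes at the end. In the case of a prime square, the bound by φ(d)
-- comes for free: φ(d) ≤ φ(n), and φ(n) is itself a term of the sum, since n ∈ X.

1ᴿ : ℝ
1ᴿ = ℝᶜ.1#

-- The default 0 at 0 makes the inverse total: an invertible Cauchy sequence may still vanish at
-- finitely many places.
inverse : ℚ → ℚ
inverse q with q ℚₚ.≟ 0ℚ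
... | yes _ = 0ℚ
... | no q≢0 = ℚ.1/_ q {{ℚ.≢-nonZero q≢0}}

*-inverse : ∀ {q} → q ≢ 0ℚ → inverse q ℚ.* q ≡ 1ℚ
*-inverse {q} q≢0 with q ℚₚ.≟ 0ℚ
... | yes q≡0 = contradiction q≡0 q≢0
... | no q≢0′ = ℚₚ.*-inverseˡ q {{ℚ.≢-nonZero q≢0′}}

-- With x bounded away from 0 by δ, |1/x m - 1/x n| ≤ |x n - x m| / δ².
inverse-exists : ∀ x {δ} N → 0ℚ ℚ.< δ → (∀ {m} → N ≤ m → δ ℚ.≤ ∣ seq x m ∣) →
                 ∃ λ y → y *ᴿ x ≃ 1ᴿ
inverse-exists x {δ} N 0<δ δ≤∣x∣ = mkℝ (inverse ∘ seq x) y-cauchy ,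
  mk≃ λ ε 0<ε → N , λ N≤m N≤n → subst (ℚ._< ε)
    (sym (cong ∣_∣ (trans (cong (ℚ._- 1ℚ) (*-inverse (x≢0 N≤m))) (ℚₚ.+-inverseʳ 1ℚ)))) 0<ε
  where
  x≢0 : ∀ {m} → N ≤ m → seq x m ≢ 0ℚ
  x≢0 N≤m eq = ℚₚ.<-irrefl refl (ℚₚ.<-≤-trans 0<δ (subst (δ ℚ.≤_) (cong ∣_∣ eq) (δ≤∣x∣ N≤m)))
  instance
    δ⁺ : ℚ.Positive δ
    δ⁺ = ℚ.positive 0<δ
    δ²⁺ : ℚ.Positive (δ ℚ.* δ)
    δ²⁺ = ℚₚ.pos*pos⇒pos δ δ
  y-cauchy : Close (inverse ∘ seq x) (inverse ∘ seq x)
  y-cauchy ε 0<ε with cauchy x (ε ℚ.* (δ ℚ.* δ))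
    (ℚₚ.positive⁻¹ _ {{ℚₚ.pos*pos⇒pos ε {{ℚ.positive 0<ε}} (δ ℚ.* δ)}})
  ... | L , close-x = N ℕ.⊔ L , λ {m} {n} m≥ n≥ →
    let N≤m = ℕₚ.≤-trans (ℕₚ.m≤m⊔n N L) m≥
        N≤n = ℕₚ.≤-trans (ℕₚ.m≤m⊔n N L) n≥
        L≤m = ℕₚ.≤-trans (ℕₚ.m≤n⊔m N L) m≥
        L≤n = ℕₚ.≤-trans (ℕₚ.m≤n⊔m N L) n≥
        a = seq x m
        b = seq x n
        a′ = inverse a
        b′ = inverse b
    in ℚₚ.*-cancelʳ-<-nonNeg (δ ℚ.* δ) {{ℚₚ.pos⇒nonNeg (δ ℚ.* δ)}} (begin-strict
      ∣ a′ ℚ.- b′ ∣ ℚ.* (δ ℚ.* δ)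
        ≤⟨ ℚₚ.*-monoˡ-≤-nonNeg ∣ a′ ℚ.- b′ ∣ {{ℚₚ.∣-∣-nonNeg (a′ ℚ.- b′)}} (δ²≤ N≤m N≤n) ⟩
      ∣ a′ ℚ.- b′ ∣ ℚ.* (∣ a ∣ ℚ.* ∣ b ∣)
        ≡⟨ cong (∣ a′ ℚ.- b′ ∣ ℚ.*_) (ℚₚ.∣p*q∣≡∣p∣*∣q∣ a b) ⟨
      ∣ a′ ℚ.- b′ ∣ ℚ.* ∣ a ℚ.* b ∣
        ≡⟨ ℚₚ.∣p*q∣≡∣p∣*∣q∣ (a′ ℚ.- b′) (a ℚ.* b) ⟨
      ∣ (a′ ℚ.- b′) ℚ.* (a ℚ.* b) ∣
        ≡⟨ cong ∣_∣ (cross N≤m N≤n) ⟩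
      ∣ b ℚ.- a ∣
        <⟨ close-x L≤n L≤m ⟩
      ε ℚ.* (δ ℚ.* δ) ∎)
    where
    open ℚₚ.≤-Reasoning
    δ²≤ : ∀ {m n} → N ≤ m → N ≤ n → δ ℚ.* δ ℚ.≤ ∣ seq x m ∣ ℚ.* ∣ seq x n ∣
    δ²≤ {m} {n} N≤m N≤n = begin
      δ ℚ.* δ
        ≤⟨ ℚₚ.*-monoʳ-≤-nonNeg δ {{ℚₚ.pos⇒nonNeg δ}} (δ≤∣x∣ N≤m) ⟩
      ∣ seq x m ∣ ℚ.* δ
        ≤⟨ ℚₚ.*-monoˡ-≤-nonNeg ∣ seq x m ∣ {{ℚₚ.∣-∣-nonNeg (seq x m)}} (δ≤∣x∣ N≤n) ⟩
      ∣ seq x m ∣ ℚ.* ∣ seq x n ∣ ∎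
    cross : ∀ {m n} → N ≤ m → N ≤ n →
            (inverse (seq x m) ℚ.- inverse (seq x n)) ℚ.* (seq x m ℚ.* seq x n)
            ≡ seq x n ℚ.- seq x m
    cross {m} {n} N≤m N≤n = trans
      (ℚ-solve 4 (λ a b a′ b′ → (a′ :- b′) :* (a :* b) := a′ :* a :* b :- b′ :* b :* a) refl
        (seq x m) (seq x n) (inverse (seq x m)) (inverse (seq x n)))
      (cong₂ (λ p q → p ℚ.- q)
        (trans (cong (ℚ._* seq x n) (*-inverse (x≢0 N≤m))) (ℚₚ.*-identityˡ (seq x n)))
        (trans (cong (ℚ._* seq x m) (*-inverse (x≢0 N≤n))) (ℚₚ.*-identityˡ (seq x m))))

-- The only case distinction is between rationals: for each ε, a late term of the sequence is either
-- at least ε/2, which would make `x` invertible, or smaller.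
noninvertible⇒≃0 : ∀ x → (∀ y → ¬ y *ᴿ x ≃ 1ᴿ) → x ≃ 0ᴿ
noninvertible⇒≃0 x noninvertible = mk≃ null
  where
  open ℚₚ.≤-Reasoning
  half>0 : ∀ {ε} → 0ℚ ℚ.< ε → 0ℚ ℚ.< ε ℚ.* ½
  half>0 {ε} 0<ε = ℚₚ.positive⁻¹ _ {{ℚₚ.pos*pos⇒pos ε {{ℚ.positive 0<ε}} ½}}
  half+half : ∀ ε → ε ℚ.* ½ ℚ.+ ε ℚ.* ½ ≡ ε
  half+half = ℚ-solve 1 (λ e → e :* con ½ :+ e :* con ½ := e) refl
  ∣p∣≤∣p-q∣+∣q∣ : ∀ p q → ∣ p ∣ ℚ.≤ ∣ p ℚ.- q ∣ ℚ.+ ∣ q ∣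
  ∣p∣≤∣p-q∣+∣q∣ p q = subst (λ r → ∣ r ∣ ℚ.≤ ∣ p ℚ.- q ∣ ℚ.+ ∣ q ∣)
    (ℚ-solve 2 (λ p q → (p :- q) :+ q := p) refl p q) (ℚₚ.∣p+q∣≤∣p∣+∣q∣ (p ℚ.- q) q)
  null : Close (seq x) (λ _ → 0ℚ)
  -- With oscillation below ε/4, a term of size at least ε/2 keeps all later ones at least ε/4, and
  -- a term below ε/2 keeps them below ε/4 + ε/2 ≤ ε.
  null ε 0<ε with cauchy x (ε ℚ.* ½ ℚ.* ½) (half>0 (half>0 0<ε))
  ... | N , close-x with ε ℚ.* ½ ℚₚ.≤? ∣ seq x N ∣
  ...   | yes large = contradiction
    (proj₂ (inverse-exists x N (half>0 (half>0 0<ε)) away)) (noninvertible _)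
    where
    away : ∀ {m} → N ≤ m → ε ℚ.* ½ ℚ.* ½ ℚ.≤ ∣ seq x m ∣
    away {m} N≤m = ℚₚ.≮⇒≥ λ small → ℚₚ.<-irrefl refl (ℚₚ.<-≤-trans (begin-strict
      ∣ seq x N ∣
        ≤⟨ ∣p∣≤∣p-q∣+∣q∣ (seq x N) (seq x m) ⟩
      ∣ seq x N ℚ.- seq x m ∣ ℚ.+ ∣ seq x m ∣
        <⟨ ℚₚ.+-mono-< (close-x ℕₚ.≤-refl N≤m) small ⟩
      ε ℚ.* ½ ℚ.* ½ ℚ.+ ε ℚ.* ½ ℚ.* ½
        ≡⟨ half+half (ε ℚ.* ½) ⟩
      ε ℚ.* ½ ∎) large)
  ...   | no small = N , λ {m} N≤m _ → begin-strict
    ∣ seq x m ℚ.- 0ℚ ∣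
      ≡⟨ cong ∣_∣ (ℚₚ.+-identityʳ (seq x m)) ⟩
    ∣ seq x m ∣
      ≤⟨ ∣p∣≤∣p-q∣+∣q∣ (seq x m) (seq x N) ⟩
    ∣ seq x m ℚ.- seq x N ∣ ℚ.+ ∣ seq x N ∣
      <⟨ ℚₚ.+-mono-< (close-x N≤m ℕₚ.≤-refl) (ℚₚ.≰⇒> small) ⟩
    ε ℚ.* ½ ℚ.* ½ ℚ.+ ε ℚ.* ½
      ≤⟨ ℚₚ.+-monoˡ-≤ (ε ℚ.* ½) quarter≤half ⟩
    ε ℚ.* ½ ℚ.+ ε ℚ.* ½
      ≡⟨ half+half ε ⟩
    ε ∎
    where
    quarter≤half : ε ℚ.* ½ ℚ.* ½ ℚ.≤ ε ℚ.* ½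
    quarter≤half = subst (ε ℚ.* ½ ℚ.* ½ ℚ.≤_) (half+half (ε ℚ.* ½))
      (ℚₚ.≤-trans (ℚₚ.≤-reflexive (sym (ℚₚ.+-identityʳ _)))
                  (ℚₚ.+-monoʳ-≤ (ε ℚ.* ½ ℚ.* ½) (ℚₚ.<⇒≤ (half>0 (half>0 0<ε)))))

1≄0 : ¬ 1ᴿ ≃ 0ᴿ
1≄0 (mk≃ c) with c 1ℚ (ℚₚ.positive⁻¹ 1ℚ)
... | N , p = ℚₚ.<-irrefl refl (p (ℕₚ.≤-refl {N}) ℕₚ.≤-refl)

-- Kernels in echelon form

∑-zero : ∀ {n} (f : Vector ℝ n) → f ≋ 𝟎 → ∑ f ≃ 0ᴿ
∑-zero {n} f f≋𝟎 = ≃-trans (sum-cong-≋ f≋𝟎) (sum-replicate-zero n)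

∑-single : ∀ {n} (f : Vector ℝ n) i → (∀ j → j ≢ i → f j ≃ 0ᴿ) → ∑ f ≃ f i
∑-single {suc n} f i f≃0 = begin
  ∑ f                       ≈⟨ sum-remove {i = i} f ⟩
  f i +ᴿ ∑ (removeAt f i)   ≈⟨ ℝᶜ.+-congˡ (∑-zero _ λ j → f≃0 _ (Finₚ.punchInᵢ≢i i j)) ⟩
  f i +ᴿ 0ᴿ                 ≈⟨ ℝᶜ.+-identityʳ (f i) ⟩
  f i                       ∎
  where open ≃-Reasoning

module _ {N} (A : Matrix N) where
  open ≃-Reasoning

  kernel-linear : ∀ {v w} c → Kernel A v → Kernel A w → Kernel A (λ i → v i +ᴿ c *ᴿ w i)
  kernel-linear {v} {w} c Av≋0 Aw≋0 i = begin
    ∑ (λ j → A i j *ᴿ (v j +ᴿ c *ᴿ w j))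
      ≈⟨ sum-cong-≋ (λ j → ≗⇒≃ _ _ λ n → ℚ-solve 4
           (λ a v c w → a :* (v :+ c :* w) := a :* v :+ c :* (a :* w)) refl
           (seq (A i j) n) (seq (v j) n) (seq c n) (seq (w j) n)) ⟩
    ∑ (λ j → A i j *ᴿ v j +ᴿ c *ᴿ (A i j *ᴿ w j))
      ≈⟨ ∑-distrib-+ (λ j → A i j *ᴿ v j) (λ j → c *ᴿ (A i j *ᴿ w j)) ⟩
    (A · v) i +ᴿ ∑ (λ j → c *ᴿ (A i j *ᴿ w j))
      ≈⟨ +ᴿ-cong (Av≋0 i) (≃-sym (*-distribˡ-sum c (λ j → A i j *ᴿ w j))) ⟩
    0ᴿ +ᴿ c *ᴿ (A · w) i
      ≈⟨ ℝᶜ.+-identityˡ _ ⟩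
    c *ᴿ (A · w) i
      ≈⟨ ℝᶜ.*-congˡ (Aw≋0 i) ⟩
    c *ᴿ 0ᴿ
      ≈⟨ ℝᶜ.zeroʳ c ⟩
    0ᴿ ∎

  kernel-combination : ∀ {k} (b : Fin k → Vector ℝ N) c → (∀ j → Kernel A (b j)) →
                       Kernel A (combination b c)
  kernel-combination {zero} b c b∈ i = ∑-zero _ λ j → ℝᶜ.zeroʳ (A i j)
  kernel-combination {suc k} b c b∈ i = begin
    (A · combination b c) i
      ≈⟨ sum-cong-≋ (λ j → ℝᶜ.*-congˡ {A i j} (ℝᶜ.+-comm (c zero *ᴿ b zero j) _)) ⟩
    (A · (λ j → combination (b ∘ suc) (c ∘ suc) j +ᴿ c zero *ᴿ b zero j)) i
      ≈⟨ kernel-linear (c zero) (kernel-combination (b ∘ suc) (c ∘ suc) (b∈ ∘ suc)) (b∈ zero) i ⟩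
    0ᴿ ∎

  -- The rows at the pivots form an identity matrix, so the coefficients of a combination are its
  -- values at the pivots.
  record EchelonKernel (k : ℕ) : Set where
    field
      vector    : Fin k → Vector ℝ N
      inside    : ∀ j → Kernel A (vector j)
      pivot     : Fin k → Fin N
      pivot-one : ∀ j → vector j (pivot j) ≃ 1ᴿ
      pivot-zero : ∀ {i j} → i ≢ j → vector j (pivot i) ≃ 0ᴿ

    pivot-injective : ∀ {i j} → pivot i ≡ pivot j → i ≡ j
    pivot-injective {i} {j} eq with i Finₚ.≟ j
    ... | yes i≡j = i≡j
    ... | no i≢j = contradiction
      (≃-trans (≃-sym (pivot-one j)) (subst (λ p → vector j p ≃ 0ᴿ) eq (pivot-zero i≢j))) 1≄0

    combination-pivot : ∀ c i → combination vector c (pivot i) ≃ c i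
    combination-pivot c i = begin
      combination vector c (pivot i)
        ≈⟨ ∑-single (λ j → c j *ᴿ vector j (pivot i)) i (λ j j≢i →
             ≃-trans (ℝᶜ.*-congˡ {c j} (pivot-zero (j≢i ∘ sym))) (ℝᶜ.zeroʳ (c j))) ⟩
      c i *ᴿ vector i (pivot i)
        ≈⟨ ℝᶜ.*-congˡ {c i} (pivot-one i) ⟩
      c i *ᴿ 1ᴿ
        ≈⟨ ℝᶜ.*-identityʳ (c i) ⟩
      c i ∎

  open EchelonKernel

  echelon-size : ∀ {k} → EchelonKernel k → k ≤ N
  echelon-size E = Finₚ.injective⇒≤ (pivot-injective E)

  VanishesOnPivots : ∀ {k} → EchelonKernel k → Vector ℝ N → Set
  VanishesOnPivots E f = ∀ j → f (pivot E j) ≃ 0ᴿ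

  -- A Gauss-Jordan step: `f` is scaled to 1 at the new pivot `i`, and a multiple of it clears that
  -- coordinate in each old vector. The old pivot entries survive because `f` vanishes there.
  extend : ∀ {k} (E : EchelonKernel k) f i y → Kernel A f → VanishesOnPivots E f →
           y *ᴿ f i ≃ 1ᴿ → EchelonKernel (suc k)
  extend E f i y f∈ f≃0 yfᵢ≃1 = record
    { vector     = (λ j → y *ᴿ f j) ∷ᵛ λ l j → vector E l j +ᴿ (-ᴿ vector E l i *ᴿ y) *ᴿ f j
    ; inside     = λ { zero → λ l → ≃-trans
                         (sum-cong-≋ λ j → ℝᶜ.*-congˡ {A l j} (≃-sym (ℝᶜ.+-identityˡ (y *ᴿ f j))))
                         (kernel-linear y (λ l → ∑-zero _ λ j → ℝᶜ.zeroʳ (A l j)) f∈ l)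
                     ; (suc l) → kernel-linear (-ᴿ vector E l i *ᴿ y) (inside E l) f∈ }
    ; pivot      = i ∷ᵛ pivot E
    ; pivot-one  = λ { zero → yfᵢ≃1 ; (suc l) → ≃-trans (unchanged l l) (pivot-one E l) }
    ; pivot-zero = λ { {zero} {zero} ne → contradiction refl ne
                     ; {zero} {suc l} _ → cleared l
                     ; {suc l} {zero} _ → ≃-trans (ℝᶜ.*-congˡ {y} (f≃0 l)) (ℝᶜ.zeroʳ y)
                     ; {suc l} {suc l′} ne →
                         ≃-trans (unchanged l′ l) (pivot-zero E (ne ∘ cong suc)) }
    }
    where
    unchanged : ∀ l l′ → vector E l (pivot E l′) +ᴿ (-ᴿ vector E l i *ᴿ y) *ᴿ f (pivot E l′)
                         ≃ vector E l (pivot E l′)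
    unchanged l l′ = begin
      vector E l (pivot E l′) +ᴿ (-ᴿ vector E l i *ᴿ y) *ᴿ f (pivot E l′)
        ≈⟨ ℝᶜ.+-congˡ (ℝᶜ.*-congˡ { -ᴿ vector E l i *ᴿ y} (f≃0 l′)) ⟩
      vector E l (pivot E l′) +ᴿ (-ᴿ vector E l i *ᴿ y) *ᴿ 0ᴿ
        ≈⟨ ℝᶜ.+-congˡ (ℝᶜ.zeroʳ _) ⟩
      vector E l (pivot E l′) +ᴿ 0ᴿ
        ≈⟨ ℝᶜ.+-identityʳ _ ⟩
      vector E l (pivot E l′) ∎
    cleared : ∀ l → vector E l i +ᴿ (-ᴿ vector E l i *ᴿ y) *ᴿ f i ≃ 0ᴿ
    cleared l = begin
      vector E l i +ᴿ (-ᴿ vector E l i *ᴿ y) *ᴿ f i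
        ≈⟨ ℝᶜ.+-congˡ (ℝᶜ.*-assoc (-ᴿ vector E l i) y (f i)) ⟩
      vector E l i +ᴿ -ᴿ vector E l i *ᴿ (y *ᴿ f i)
        ≈⟨ ℝᶜ.+-congˡ (ℝᶜ.*-congˡ { -ᴿ vector E l i} yfᵢ≃1) ⟩
      vector E l i +ᴿ -ᴿ vector E l i *ᴿ 1ᴿ
        ≈⟨ ℝᶜ.+-congˡ (ℝᶜ.*-identityʳ (-ᴿ vector E l i)) ⟩
      vector E l i +ᴿ -ᴿ vector E l i
        ≈⟨ ℝᶜ.-‿inverseʳ (vector E l i) ⟩
      0ᴿ ∎

  -- Subtracting from `v` the combination whose coefficients are the values of `v` at the pivots
  -- leaves a kernel vector that vanishes on all pivots, hence 0.
  maximal⇒basis : ∀ {k} (E : EchelonKernel k) →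
                  (∀ f → Kernel A f → VanishesOnPivots E f → f ≋ 𝟎) → HasNullity A k
  maximal⇒basis E maximal = vector E , record
    { inside      = inside E
    ; independent = λ c comb≋0 i →
        ≃-trans (≃-sym (combination-pivot E c i)) (comb≋0 (pivot E i))
    ; spanning    = λ v v∈ → v ∘ pivot E , λ i → begin
        v i
          ≈⟨ ≗⇒≃ _ _ (λ n → ℚ-solve 2 (λ v c → v := (v :+ :- con 1ℚ :* c) :+ c) refl
               (seq (v i) n) (seq (combination (vector E) (v ∘ pivot E) i) n)) ⟩
        (v i +ᴿ -ᴿ 1ᴿ *ᴿ combination (vector E) (v ∘ pivot E) i)
          +ᴿ combination (vector E) (v ∘ pivot E) i
          ≈⟨ ℝᶜ.+-congʳ (maximal _
               (kernel-linear (-ᴿ 1ᴿ) v∈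
                 (kernel-combination (vector E) (v ∘ pivot E) (inside E)))
               (λ j → begin
                 v (pivot E j) +ᴿ -ᴿ 1ᴿ *ᴿ combination (vector E) (v ∘ pivot E) (pivot E j)
                   ≈⟨ ℝᶜ.+-congˡ (ℝᶜ.*-congˡ { -ᴿ 1ᴿ} (combination-pivot E (v ∘ pivot E) j)) ⟩
                 v (pivot E j) +ᴿ -ᴿ 1ᴿ *ᴿ v (pivot E j)
                   ≈⟨ ≗⇒≃ _ _ (λ n → ℚ-solve 1 (λ v → v :+ :- con 1ℚ :* v := con 0ℚ) refl
                        (seq (v (pivot E j)) n)) ⟩
                 0ᴿ ∎) i) ⟩
        0ᴿ +ᴿ combination (vector E) (v ∘ pivot E) i
          ≈⟨ ℝᶜ.+-identityˡ _ ⟩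
        combination (vector E) (v ∘ pivot E) i ∎
    }

  -- Bases of real subspaces exist only up to double negation.
  ¬¬nullity≥ : ∀ {k} → EchelonKernel k → ¬ ¬ ∃ λ K → k ≤ K × HasNullity A K
  ¬¬nullity≥ {k} E = go (N ℕ.∸ k) E (ℕₚ.≤-reflexive (sym (ℕₚ.m+[n∸m]≡n (echelon-size E))))
    where
    -- The fuel `t` bounds the number of pivots that can still be added.
    go : ∀ {k} t → EchelonKernel k → N ≤ k ℕ.+ t → ¬ ¬ ∃ λ K → k ≤ K × HasNullity A K
    bigger : ∀ {k} t → EchelonKernel (suc k) → N ≤ k ℕ.+ t → ¬ ¬ ∃ λ K → k ≤ K × HasNullity A K
    -- Since the goal is absurdity, `E` may be claimed maximal: any invertible entry of a further
    -- kernel vector yields a larger system, which the recursion refutes.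
    go t E N≤k+t none = none (_ , ℕₚ.≤-refl , maximal⇒basis E λ f f∈ f≃0 i →
      noninvertible⇒≃0 (f i) λ y yfᵢ≃1 → bigger t (extend E f i y f∈ f≃0 yfᵢ≃1) N≤k+t none)
    bigger zero E N≤k none = ℕₚ.<⇒≱ (echelon-size E) (subst (N ≤_) (ℕₚ.+-identityʳ _) N≤k)
    bigger {k} (suc t) E N≤k+t none =
      go t E (subst (N ≤_) (ℕₚ.+-suc k t) N≤k+t)
        λ (K , k<K , h) → none (K , ℕₚ.<⇒≤ k<K , h)

-- An inequality of naturals is decidable, hence stable, so a basis known only up to double negation
-- suffices.
maximumNullity≥ : ∀ {v ℓ e N} {V : Setoid v ℓ} {u : Enumeration N V} {Γ : SimpleGraph V e} {M k} →
                  IsMaximumNullity u Γ M → ∀ A → Pattern u Γ A → EchelonKernel A k → M ≥ k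
maximumNullity≥ {M = M} {k} max A A∈ E = decidable-stable (k ℕₚ.≤? M) λ k≰M →
  ¬¬nullity≥ A E λ (K , k≤K , h) → k≰M (ℕₚ.≤-trans k≤K (IsMaximumNullity.upperBound max A K A∈ h))

-- Residues, units and radicals

-- Reduction modulo 0 is the identity.
rem : ℕ → ℕ → ℕ
rem i zero    = i
rem i (suc d) = i % suc d

rem≡% : ∀ i d .{{_ : NonZero d}} → rem i d ≡ i % d
rem≡% i (suc d) = refl

rem-< : ∀ {i d} → i < d → rem i d ≡ i
rem-< {d = suc d} i<d = m<n⇒m%n≡m i<d

rem-+-∣ : ∀ i {d s} → d ∣ s → rem (i + s) d ≡ rem i d
rem-+-∣ i {zero}  d∣s = trans (cong (i +_) (0∣⇒≡0 d∣s)) (ℕₚ.+-identityʳ i)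
rem-+-∣ i {suc d} d∣s = %-remove-+ʳ i d∣s

rem-+-congˡ : ∀ {i j} s d → rem i d ≡ rem j d → rem (s + i) d ≡ rem (s + j) d
rem-+-congˡ s zero eq = cong (s +_) eq
rem-+-congˡ {i} {j} s (suc d) eq = begin
  (s + i) % suc d                     ≡⟨ %-distribˡ-+ s i (suc d) ⟩
  (s % suc d + i % suc d) % suc d     ≡⟨ cong (λ r → (s % suc d + r) % suc d) eq ⟩
  (s % suc d + j % suc d) % suc d     ≡⟨ %-distribˡ-+ s j (suc d) ⟨
  (s + j) % suc d                     ∎
  where open ≡-Reasoning

rem-+-cancelˡ : ∀ {i j} s d → rem (s + i) d ≡ rem (s + j) d → rem i d ≡ rem j d
rem-+-cancelˡ s zero eq = ℕₚ.+-cancelˡ-≡ s _ _ eq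
rem-+-cancelˡ {i} {j} s (suc d) eq = begin
  i % suc d                   ≡⟨ complement i ⟨
  (s * d + (s + i)) % suc d   ≡⟨ rem-+-congˡ (s * d) (suc d) eq ⟩
  (s * d + (s + j)) % suc d   ≡⟨ complement j ⟩
  j % suc d                   ∎
  where
  open ≡-Reasoning
  rearrange : ∀ s d k → s * d + (s + k) ≡ k + s * suc d
  rearrange = solve-∀
  complement : ∀ k → (s * d + (s + k)) % suc d ≡ k % suc d
  complement k = trans
    (cong (_% suc d) (rearrange s d k))
    ([m+kn]%n≡m%n k s (suc d))

rem≡⇒∣ : ∀ i t {d} → rem (i + t) d ≡ rem i d → d ∣ t
rem≡⇒∣ i t {d} eq = rem≡0⇒∣ d (rem-+-cancelˡ i d (trans eq (cong (λ j → rem j d) (sym (ℕₚ.+-identityʳ i)))))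
  where
  rem≡0⇒∣ : ∀ d → rem t d ≡ rem 0 d → d ∣ t
  rem≡0⇒∣ zero    eq = subst (0 ∣_) (sym eq) ∣-refl
  rem≡0⇒∣ (suc d) eq = m%n≡0⇒n∣m t (suc d) eq

∣⇒rem≡ : ∀ {d t} → d ∣ t → rem t d ≡ rem 0 d
∣⇒rem≡ = rem-+-∣ 0

rem-≡-∣ : ∀ {d n i j} → d ∣ n → rem i n ≡ rem j n → rem i d ≡ rem j d
rem-≡-∣ {n = zero} _ refl = refl
rem-≡-∣ {zero} {suc n} d∣n _ = case 0∣⇒≡0 d∣n of λ ()
rem-≡-∣ {suc d} {suc n} {i} {j} d∣n eq = trans (sym (m∣n⇒o%n%m≡o%m (suc d) (suc n) i d∣n))
  (trans (cong (_% suc d) eq) (m∣n⇒o%n%m≡o%m (suc d) (suc n) j d∣n))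

-- The Chinese remainder theorem for the residues `x` modulo `p` and 0 modulo `m`. Over ℕ the Bézout
-- identity comes with either sign, v m ≡ 1 or v m ≡ -1 modulo `p`, and each sign has its own
-- witness.
coprime-shift : ∀ {p m} → Coprime p m → ∀ x → ∃ λ s → m ∣ s × rem s p ≡ rem x p
coprime-shift {p} {m} p⊥m x with Coprime.coprime-Bézout p⊥m
... | Bézout.-+ u v 1+up≡vm = x * (v * m) , ∣n⇒∣m*n x (n∣m*n v) , (begin
  rem (x * (v * m)) p       ≡⟨ cong (λ k → rem (x * k) p) 1+up≡vm ⟨
  rem (x * (1 + u * p)) p   ≡⟨ cong (λ k → rem k p) (ℕₚ.*-suc x (u * p)) ⟩
  rem (x + x * (u * p)) p   ≡⟨ rem-+-∣ x {p} (∣n⇒∣m*n x (n∣m*n u)) ⟩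
  rem x p                   ∎)
  where open ≡-Reasoning
... | Bézout.+- u v 1+vm≡up = s , ∣n⇒∣m*n x (∣n⇒∣m*n (v * m) (n∣m*n v)) , (begin
  rem s p
    ≡⟨ rem-+-∣ s {p} (∣n⇒∣m*n x (n∣m*n u)) ⟨
  rem (s + x * (u * p)) p
    ≡⟨ cong (λ k → rem (s + x * k) p) 1+vm≡up ⟨
  rem (s + x * (1 + v * m)) p
    ≡⟨ cong (λ k → rem k p) (expand x (v * m)) ⟩
  rem (x + x * (v * m * (1 + v * m))) p
    ≡⟨ cong (λ k → rem (x + x * (v * m * k)) p) 1+vm≡up ⟩
  rem (x + x * (v * m * (u * p))) p
    ≡⟨ rem-+-∣ x {p} (∣n⇒∣m*n x (∣n⇒∣m*n (v * m) (n∣m*n u))) ⟩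
  rem x p ∎)
  where
  open ≡-Reasoning
  expand : ∀ x w → x * (w * w) + x * (1 + w) ≡ x + x * (w * (1 + w))
  expand = solve-∀
  -- v m ≡ -1 modulo p, so its square is 1.
  s : ℕ
  s = x * (v * m * (v * m))

noCommonPrime⇒coprime : ∀ {t n} .{{_ : NonZero n}} →
                        (∀ {p} → Prime p → p ∣ t → ¬ p ∣ n) → Coprime t n
noCommonPrime⇒coprime {t} {n} none {zero} (_ , 0∣n) = contradiction (0∣⇒≡0 0∣n) (ℕ.≢-nonZero⁻¹ n)
noCommonPrime⇒coprime {t} {n} none {g@(suc _)} (g∣t , g∣n) with factorise g
... | record { factors = [] ; isFactorisation = g≡1 } = g≡1
... | record { factors = p ∷ ps ; isFactorisation = g≡ ; factorsPrime = prime-p ∷ _ } =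
  contradiction (∣-trans p∣g g∣n) (none prime-p (∣-trans p∣g g∣t))
  where
  p∣g : p ∣ g
  p∣g = subst (p ∣_) (sym g≡) (m∣m*n (product ps))

prime∤⇒coprime : ∀ {p m} → Prime p → ¬ p ∣ m → Coprime p m
prime∤⇒coprime {p} prime-p p∤m {d} (d∣p , d∣m) with prime⇒irreducible prime-p d∣p
... | inj₁ d≡1 = d≡1
... | inj₂ refl = contradiction d∣m p∤m

coprime⇒prime∤ : ∀ {p t n} → Prime p → Coprime t n → p ∣ n → ¬ p ∣ t
coprime⇒prime∤ prime-p t⊥n p∣n p∣t with t⊥n (p∣t , p∣n)
... | refl = ¬prime[1] prime-p

coprime-* : ∀ {t m n} .{{_ : NonZero (m * n)}} → Coprime t m → Coprime t n → Coprime t (m * n)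
coprime-* {m = m} {n} t⊥m t⊥n = noCommonPrime⇒coprime λ prime-p p∣t p∣mn →
  case euclidsLemma m n prime-p p∣mn of λ where
    (inj₁ p∣m) → coprime⇒prime∤ prime-p t⊥m p∣m p∣t
    (inj₂ p∣n) → coprime⇒prime∤ prime-p t⊥n p∣n p∣t

-- Counting with lists without repetition

∈-range⁺ : ∀ {i n} → 1 ≤ i → i ≤ n → i ∈ range n
∈-range⁺ {suc i} _ i<n = ∈-map⁺ suc (∈-upTo⁺ i<n)

∈-range⁻ : ∀ {i n} → i ∈ range n → 1 ≤ i × i ≤ n
∈-range⁻ i∈ with ∈-map⁻ suc i∈
... | j , j∈ , refl = s≤s z≤n , ∈-upTo⁻ j∈

range-unique : ∀ n → Unique (range n)
range-unique n = Uniqueₚ.map⁺ ℕₚ.suc-injective (Uniqueₚ.upTo⁺ n)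

length-range : ∀ n → length (range n) ≡ n
length-range n = trans (length-map suc (upTo n)) (length-upTo n)

module _ {a} {A : Set a} where
  index-injective : ∀ {x y} {ys : List A} (x∈ : x ∈ ys) (y∈ : y ∈ ys) → Any.index x∈ ≡ Any.index y∈ → x ≡ y
  index-injective = Membershipₚ.index-injective (≡ₚ.setoid A)

  map-unique : ∀ {b} {B : Set b} {f : A → B} {xs} → Unique xs →
               (∀ {x y} → x ∈ xs → y ∈ xs → f x ≡ f y → x ≡ y) → Unique (map f xs)
  map-unique [] _ = []
  map-unique {f = f} {x ∷ xs} (x∉ ∷ uniq) inj =
    All.tabulate (λ y∈ eq → case ∈-map⁻ f y∈ of λ where
      (z , z∈ , refl) → All.lookup x∉ z∈ (inj (here refl) (there z∈) eq))
    ∷ map-unique uniq λ x∈ y∈ → inj (there x∈) (there y∈)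

  lookup-injective : ∀ {xs : List A} → Unique xs → ∀ {i j} → lookup xs i ≡ lookup xs j → i ≡ j
  lookup-injective (_ ∷ _) {zero} {zero} _ = refl
  lookup-injective (x∉ ∷ _) {zero} {suc j} eq = contradiction eq (All.lookup x∉ (∈-lookup j))
  lookup-injective (x∉ ∷ _) {suc i} {zero} eq = contradiction (sym eq) (All.lookup x∉ (∈-lookup i))
  lookup-injective (_ ∷ uniq) {suc i} {suc j} eq = cong suc (lookup-injective uniq eq)

  -- The pigeonhole principle in the form that turns every inequality about φ below into an
  -- inclusion of lists.
  unique-⊆⇒length≤ : ∀ {xs ys : List A} → Unique xs → (∀ {x} → x ∈ xs → x ∈ ys) →
                     length xs ≤ length ys
  unique-⊆⇒length≤ {xs} {ys} uniq xs⊆ys = Finₚ.injective⇒≤ λ {i} {j} eq →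
    lookup-injective uniq (index-injective (xs⊆ys (∈-lookup i)) (xs⊆ys (∈-lookup j)) eq)

∈-divisors⁻ : ∀ {d n} → d ∈ divisors n → d ∣ n × 1 ≤ d
∈-divisors⁻ {d} {n} d∈ with ∈-filter⁻ (_∣? n) {xs = range n} d∈
... | d∈range , d∣n = d∣n , proj₁ (∈-range⁻ d∈range)

∈-divisors⁺ : ∀ {d n} .{{_ : NonZero n}} → d ∣ n → d ∈ divisors n
∈-divisors⁺ {zero}  {n} 0∣n = contradiction (0∣⇒≡0 0∣n) (ℕ.≢-nonZero⁻¹ n)
∈-divisors⁺ {suc d} {n} d∣n = ∈-filter⁺ (_∣? n) (∈-range⁺ (s≤s z≤n) (∣⇒≤ d∣n)) d∣n

units : ℕ → List ℕ
units n = filter (λ t → gcd t n ℕₚ.≟ 1) (range n)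

∈-units⁺ : ∀ {t n} → 1 ≤ t → t ≤ n → Coprime t n → t ∈ units n
∈-units⁺ {t} {n} 1≤t t≤n t⊥n = ∈-filter⁺ (λ t → gcd t n ℕₚ.≟ 1) (∈-range⁺ 1≤t t≤n) (coprime⇒gcd≡1 t⊥n)

∈-units⁻ : ∀ {t n} → t ∈ units n → 1 ≤ t × t ≤ n × Coprime t n
∈-units⁻ {t} {n} t∈ with ∈-filter⁻ (λ t → gcd t n ℕₚ.≟ 1) t∈
... | t∈range , gcd≡1 =
  proj₁ (∈-range⁻ t∈range) , proj₂ (∈-range⁻ t∈range) , gcd≡1⇒coprime gcd≡1

units-unique : ∀ n → Unique (units n)
units-unique n = Uniqueₚ.filter⁺ (λ t → gcd t n ℕₚ.≟ 1) (range-unique n)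

-- A unit t modulo m lifts to a unit modulo p m: t itself, or t + m if p ∣ t.
φ-prime-mono : ∀ {p} m .{{_ : NonZero m}} → Prime p → φ m ≤ φ (p * m)
φ-prime-mono {p} m prime-p = subst (_≤ φ (p * m)) (length-map lift (units m))
  (unique-⊆⇒length≤ lifted-unique λ u∈ → case ∈-map⁻ lift u∈ of λ where
    (t , t∈ , refl) → lift-unit t∈)
  where
  instance
    p≢0 : NonZero p
    p≢0 = prime⇒nonZero prime-p
    pm≢0 : NonZero (p * m)
    pm≢0 = ℕₚ.m*n≢0 p m
  2m≤pm : m + m ≤ p * m
  2m≤pm = subst (_≤ p * m) (cong (m +_) (ℕₚ.+-identityʳ m))
    (ℕₚ.*-monoˡ-≤ m {2} {p} (ℕ.nonTrivial⇒n>1 p {{prime⇒nonTrivial prime-p}}))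
  lift : ℕ → ℕ
  lift t with p ∣? t
  ... | yes _ = t + m
  ... | no _  = t
  lift-unit : ∀ {t} → t ∈ units m → lift t ∈ units (p * m)
  lift-unit {t} t∈ with ∈-units⁻ t∈ | p ∣? t
  ... | 1≤t , t≤m , t⊥m | yes p∣t = ∈-units⁺ (ℕₚ.≤-trans 1≤t (ℕₚ.m≤m+n t m))
    (ℕₚ.≤-trans (ℕₚ.+-monoˡ-≤ m t≤m) 2m≤pm)
    (coprime-* (Coprime.sym (prime∤⇒coprime prime-p λ p∣t+m →
                 coprime⇒prime∤ prime-p t⊥m (∣m+n∣m⇒∣n p∣t+m p∣t) p∣t))
               λ {d} (d∣t+m , d∣m) → t⊥m (∣m+n∣m⇒∣n (subst (d ∣_) (ℕₚ.+-comm t m) d∣t+m) d∣m , d∣m))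
  ... | 1≤t , t≤m , t⊥m | no p∤t = ∈-units⁺ 1≤t (ℕₚ.≤-trans t≤m (ℕₚ.m≤n*m m p))
    (coprime-* (Coprime.sym (prime∤⇒coprime prime-p p∤t)) t⊥m)
  lift-injective : ∀ {s t} → s ∈ units m → t ∈ units m → lift s ≡ lift t → s ≡ t
  lift-injective {s} {t} s∈ t∈ with ∈-units⁻ s∈ | ∈-units⁻ t∈ | p ∣? s | p ∣? t
  ... | _ | _ | yes _ | yes _ = ℕₚ.+-cancelʳ-≡ m s t
  ... | _ | _ | no _  | no _  = λ eq → eq
  ... | 1≤s , _ | _ , t≤m , _ | yes _ | no _ = λ eq →
    contradiction t≤m (ℕₚ.<⇒≱ (subst (m <_) eq (ℕₚ.+-monoˡ-≤ m 1≤s)))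
  ... | _ , s≤m , _ | 1≤t , _ | no _ | yes _ = λ eq →
    contradiction s≤m (ℕₚ.<⇒≱ (subst (m <_) (sym eq) (ℕₚ.+-monoˡ-≤ m 1≤t)))
  lifted-unique : Unique (map lift (units m))
  lifted-unique = map-unique (units-unique m) lift-injective

-- The cofactor n/d is multiplied on one prime at a time, whether or not that prime already divides
-- `d`.
φ-∣-mono : ∀ {d n} .{{_ : NonZero n}} → d ∣ n → φ d ≤ φ n
φ-∣-mono {d} {n} (divides q refl) = subst (λ q → φ d ≤ φ (q * d)) (sym q≡) (go _ primes)
  where
  instance
    q≢0 : NonZero q
    q≢0 = ℕₚ.m*n≢0⇒m≢0 q
    d≢0 : NonZero d
    d≢0 = ℕₚ.m*n≢0⇒n≢0 q
  open PrimeFactorisation (factorise q) using () renaming (isFactorisation to q≡; factorsPrime to primes)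
  go : ∀ ps → All Prime ps → φ d ≤ φ (product ps * d)
  go [] [] = ℕₚ.≤-reflexive (cong φ (sym (ℕₚ.+-identityʳ d)))
  go (p ∷ ps) (prime-p ∷ primes) = ℕₚ.≤-trans (go ps primes)
    (subst (λ k → φ (product ps * d) ≤ φ k) (sym (ℕₚ.*-assoc p (product ps) d))
      (φ-prime-mono (product ps * d) {{ℕₚ.m*n≢0 (product ps) d {{productOfPrimes≢0 primes}}}} prime-p))

-- Radicals

record Radical (n : ℕ) : Set where
  field
    radical     : ℕ
    radical-∣   : radical ∣ n
    squareFree  : SquareFree radical
    primes-∣    : ∀ {p} → Prime p → p ∣ n → p ∣ radical

-- As long as p² ∣ n, pass to n/p: it has the same prime divisors, since p still divides it.
radicalOf : ∀ n .{{_ : NonZero n}} → Radical n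
radicalOf n = <-rec (λ n → .{{NonZero n}} → Radical n) step n
  where
  step : ∀ n → (∀ {m} → m < n → .{{NonZero m}} → Radical m) → .{{NonZero n}} → Radical n
  step n rec with divisibleByPrimeSquare? n
  ... | no sf = record { radical = n ; radical-∣ = ∣-refl ; squareFree = sf ; primes-∣ = λ _ q∣n → q∣n }
  ... | yes (p , prime-p , p²∣n@(divides q n≡qp²)) = record
    { radical    = radical
    ; radical-∣  = ∣-trans radical-∣ (quotient-∣ p∣n)
    ; squareFree = squareFree
    ; primes-∣   = λ {r} prime-r r∣n → primes-∣ prime-r
        (case euclidsLemma p m prime-r (subst (r ∣_) (m∣n⇒n≡m*quotient p∣n) r∣n) of λ where
          (inj₁ r∣p) → ∣-trans r∣p p∣m
          (inj₂ r∣m) → r∣m)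
    }
    where
    p∣n : p ∣ n
    p∣n = ∣-trans (m∣m*n (p ℕ.^ 1)) p²∣n
    m : ℕ
    m = quotient p∣n
    instance
      p≢0 : NonZero p
      p≢0 = prime⇒nonZero prime-p
      p>1 : ℕ.NonTrivial p
      p>1 = prime⇒nonTrivial prime-p
      m≢0 : NonZero m
      m≢0 = quotient≢0 p∣n
    p∣m : p ∣ m
    p∣m = *-cancelˡ-∣ p (subst (p * p ∣_) (m∣n⇒n≡m*quotient p∣n)
      (subst (_∣ n) (cong (p *_) (ℕₚ.*-identityʳ p)) p²∣n))
    open Radical (rec (quotient-< p∣n))

-- Sorting 1, ..., n by gcd with n

module _ (n : ℕ) .{{_ : NonZero n}} where
  -- The equation says, without division, that `i` has additive order `x` modulo `n`. In particular
  -- `i` determines `x`, so different classes are disjoint.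
  gcdClass : ℕ → List ℕ
  gcdClass x = filter (λ i → gcd i n * x ℕₚ.≟ n) (range n)

  ∈-gcdClass⁻ : ∀ {i x} → i ∈ gcdClass x → i ∈ range n × gcd i n * x ≡ n
  ∈-gcdClass⁻ {x = x} = ∈-filter⁻ (λ i → gcd i n * x ℕₚ.≟ n) {xs = range n}

  -- For n = c x, multiplication by c maps the units modulo x into the class of x.
  φ≤length-gcdClass : ∀ {x} → x ∣ n → φ x ≤ length (gcdClass x)
  φ≤length-gcdClass {x} (divides c n≡cx) = subst (_≤ length (gcdClass x)) (length-map (c *_) (units x))
    (unique-⊆⇒length≤ (Uniqueₚ.map⁺ (ℕₚ.*-cancelˡ-≡ _ _ c) (units-unique x)) λ i∈ →
      case ∈-map⁻ (c *_) i∈ of λ where (t , t∈ , refl) → scaled t∈)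
    where
    instance
      c≢0 : NonZero c
      c≢0 = ℕ.≢-nonZero λ { refl → ℕ.≢-nonZero⁻¹ n n≡cx }
    scaled : ∀ {t} → t ∈ units x → c * t ∈ gcdClass x
    scaled {t} t∈ with ∈-units⁻ t∈
    ... | 1≤t , t≤x , t⊥x = ∈-filter⁺ (λ i → gcd i n * x ℕₚ.≟ n)
      (∈-range⁺ (ℕₚ.*-mono-≤ (ℕ.>-nonZero⁻¹ c) 1≤t)
                (subst (c * t ≤_) (sym n≡cx) (ℕₚ.*-monoʳ-≤ c t≤x)))
      (begin
        gcd (c * t) n * x         ≡⟨ cong (λ k → gcd (c * t) k * x) n≡cx ⟩
        gcd (c * t) (c * x) * x   ≡⟨ cong (_* x) (c*gcd[m,n]≡gcd[cm,cn] c t x) ⟨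
        c * gcd t x * x           ≡⟨ cong (λ k → c * k * x) (coprime⇒gcd≡1 t⊥x) ⟩
        c * 1 * x                 ≡⟨ cong (_* x) (ℕₚ.*-identityʳ c) ⟩
        c * x                     ≡⟨ n≡cx ⟨
        n                         ∎)
      where open ≡-Reasoning

  gcdClasses : List ℕ → List ℕ
  gcdClasses = concatMap gcdClass

  ∈-gcdClasses⁻ : ∀ {i} xs → i ∈ gcdClasses xs → ∃ λ x → x ∈ xs × i ∈ gcdClass x
  ∈-gcdClasses⁻ (x ∷ xs) i∈ with ∈-++⁻ (gcdClass x) i∈
  ... | inj₁ i∈x = x , here refl , i∈x
  ... | inj₂ i∈xs with ∈-gcdClasses⁻ xs i∈xs
  ...   | y , y∈ , i∈y = y , there y∈ , i∈y

  gcdClasses-unique : ∀ {xs} → Unique xs → Unique (gcdClasses xs)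
  gcdClasses-unique [] = []
  gcdClasses-unique {x ∷ xs} (x∉ ∷ uniq) = Uniqueₚ.++⁺
    (Uniqueₚ.filter⁺ (λ i → gcd i n * x ℕₚ.≟ n) (range-unique n))
    (gcdClasses-unique uniq)
    λ {i} (i∈x , i∈xs) → case ∈-gcdClasses⁻ xs i∈xs of λ where
      (y , y∈ , i∈y) → All.lookup x∉ y∈ (ℕₚ.*-cancelˡ-≡ x y (gcd i n) {{gcd≢0 i}}
        (trans (proj₂ (∈-gcdClass⁻ i∈x)) (sym (proj₂ (∈-gcdClass⁻ i∈y)))))
    where
    gcd≢0 : ∀ i → NonZero (gcd i n)
    gcd≢0 i = ℕ.≢-nonZero (gcd[m,n]≢0 i n (inj₂ (ℕ.≢-nonZero⁻¹ n)))

  ∑φ≤length-gcdClasses : ∀ {xs} → All (_∣ n) xs → ∑φ xs ≤ length (gcdClasses xs)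
  ∑φ≤length-gcdClasses [] = z≤n
  ∑φ≤length-gcdClasses {x ∷ xs} (x∣n ∷ xs∣n) =
    subst (φ x + ∑φ xs ≤_) (sym (length-++ (gcdClass x)))
      (ℕₚ.+-mono-≤ (φ≤length-gcdClass x∣n) (∑φ≤length-gcdClasses xs∣n))

  -- The radical `m` is accounted for by the `m` multiples of q = n/m in 1, ..., n. Their additive
  -- orders divide `m` and so are square-free, whereas the classes counted by the sum consist of
  -- elements whose order is not.
  ∑φ[X]+radical≤n : (r : Radical n) → ∑φ (X n) + Radical.radical r ≤ n
  ∑φ[X]+radical≤n r = begin
    ∑φ (X n) + m
      ≤⟨ ℕₚ.+-monoˡ-≤ m (∑φ≤length-gcdClasses (All.tabulate (proj₁ ∘ ∈X⁻))) ⟩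
    length (gcdClasses (X n)) + m
      ≡⟨ cong (length (gcdClasses (X n)) +_)
           (trans (length-map (q *_) (range m)) (length-range m)) ⟨
    length (gcdClasses (X n)) + length multiples
      ≡⟨ length-++ (gcdClasses (X n)) ⟨
    length (gcdClasses (X n) ++ multiples)
      ≤⟨ unique-⊆⇒length≤ (Uniqueₚ.++⁺ (gcdClasses-unique X-unique) multiples-unique disjoint)
           inside ⟩
    length (range n)
      ≡⟨ length-range n ⟩
    n ∎
    where
    open ℕₚ.≤-Reasoning
    open Radical r renaming (radical to m)
    q : ℕ
    q = quotient radical-∣
    n≡qm : n ≡ q * m
    n≡qm = m∣n⇒n≡quotient*m radical-∣
    instance
      q≢0 : NonZero q
      q≢0 = ℕ.≢-nonZero λ q≡0 → ℕ.≢-nonZero⁻¹ n (trans n≡qm (cong (_* m) q≡0))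
    multiples : List ℕ
    multiples = map (q *_) (range m)
    multiples-unique : Unique multiples
    multiples-unique = Uniqueₚ.map⁺ (ℕₚ.*-cancelˡ-≡ _ _ q) (range-unique m)
    X-unique : Unique (X n)
    X-unique = Uniqueₚ.filter⁺ divisibleByPrimeSquare? (Uniqueₚ.filter⁺ (_∣? n) (range-unique n))
    ∈X⁻ : ∀ {x} → x ∈ X n → x ∣ n × DivisibleByPrimeSquare x
    ∈X⁻ x∈ with ∈-filter⁻ divisibleByPrimeSquare? {xs = divisors n} x∈
    ... | x∈divisors , p²∣x = proj₁ (∈-divisors⁻ x∈divisors) , p²∣x
    inside : ∀ {i} → i ∈ gcdClasses (X n) ++ multiples → i ∈ range n
    inside i∈ with ∈-++⁻ (gcdClasses (X n)) i∈
    ... | inj₁ i∈classes = proj₁ (∈-gcdClass⁻ (proj₂ (proj₂ (∈-gcdClasses⁻ (X n) i∈classes))))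
    ... | inj₂ i∈multiples with ∈-map⁻ (q *_) i∈multiples
    ...   | j , j∈ , refl = ∈-range⁺
      (ℕₚ.*-mono-≤ (ℕ.>-nonZero⁻¹ q) (proj₁ (∈-range⁻ j∈)))
      (subst (q * j ≤_) (sym n≡qm) (ℕₚ.*-monoʳ-≤ q (proj₂ (∈-range⁻ j∈))))
    -- If q divides i then n / gcd(i, n) divides n / q = m, which is square-free.
    disjoint : ∀ {i} → i ∈ gcdClasses (X n) × i ∈ multiples → ⊥
    disjoint (i∈classes , i∈multiples)
      with ∈-gcdClasses⁻ (X n) i∈classes | ∈-map⁻ (q *_) i∈multiples
    ... | x , x∈X , i∈x | j , _ , refl = squareFree
      (proj₁ p²∣x , proj₁ (proj₂ p²∣x) , ∣-trans (proj₂ (proj₂ p²∣x)) x∣m)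
      where
      p²∣x : DivisibleByPrimeSquare x
      p²∣x = proj₂ (∈X⁻ x∈X)
      x∣m : x ∣ m
      x∣m = *-cancelˡ-∣ q (subst (q * x ∣_) (trans (proj₂ (∈-gcdClass⁻ i∈x)) n≡qm)
        (*-monoˡ-∣ x (gcd-greatest (m∣m*n j) (quotient-∣ radical-∣))))

-- The matrices on exponents

∏ : (ℕ → ℝ) → List ℕ → ℝ
∏ f []       = 1ᴿ
∏ f (p ∷ ps) = f p *ᴿ ∏ f ps

∏-one : ∀ {f ps} → All (λ p → f p ≃ 1ᴿ) ps → ∏ f ps ≃ 1ᴿ
∏-one []         = ≃-refl
∏-one (f≃1 ∷ fs) = ≃-trans (*ᴿ-cong f≃1 (∏-one fs)) (ℝᶜ.*-identityˡ 1ᴿ)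

∏-zero : ∀ {f ps} → Any (λ p → f p ≃ 0ᴿ) ps → ∏ f ps ≃ 0ᴿ
∏-zero {f} {p ∷ ps} (here f≃0)  = ≃-trans (ℝᶜ.*-congʳ {∏ f ps} f≃0) (ℝᶜ.zeroˡ (∏ f ps))
∏-zero {f} {p ∷ ps} (there any) = ≃-trans (ℝᶜ.*-congˡ {f p} (∏-zero any)) (ℝᶜ.zeroʳ (f p))

∏-cong : ∀ {f g} {ps} → (∀ {p} → p ∈ ps → f p ≡ g p) → ∏ f ps ≡ ∏ g ps
∏-cong {ps = []}     f≡g = refl
∏-cong {ps = p ∷ ps} f≡g = cong₂ _*ᴿ_ (f≡g (here refl)) (∏-cong (f≡g ∘ there))

[_≐_] : ℕ → ℕ → ℝ
[ i ≐ j ] with i ℕₚ.≟ j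
... | yes _ = 1ᴿ
... | no _  = 0ᴿ

≐-yes : ∀ {i j} → i ≡ j → [ i ≐ j ] ≡ 1ᴿ
≐-yes {i} {j} i≡j with i ℕₚ.≟ j
... | yes _  = refl
... | no i≢j = contradiction i≡j i≢j

≐-no : ∀ {i j} → i ≢ j → [ i ≐ j ] ≡ 0ᴿ
≐-no {i} {j} i≢j with i ℕₚ.≟ j
... | yes i≡j = contradiction i≡j i≢j
... | no _    = refl

≐-cong : ∀ {i j k l} → (i ≡ j → k ≡ l) → (k ≡ l → i ≡ j) → [ i ≐ j ] ≡ [ k ≐ l ]
≐-cong {i} {j} to from with i ℕₚ.≟ j
... | yes i≡j = sym (≐-yes (to i≡j))
... | no i≢j  = sym (≐-no (i≢j ∘ from))

≐-sym : ∀ i j → [ i ≐ j ] ≡ [ j ≐ i ]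
≐-sym i j = ≐-cong sym sym

-- Propositional equality of reals is attainable here because the functions are built from
-- indicators of residues: equal residues give literally the same real.
record Periodic (m : ℕ) (f : ℕ → ℝ) : Set where
  constructor mkPeriodic
  field
    respects : ∀ {y z} → rem y m ≡ rem z m → f y ≡ f z

open Periodic

-- The sum over 0, ..., n is split at its first and at its last term; these are `f 0` and `f n`,
-- which agree by periodicity and cancel.
∑-rotate : ∀ n f → Periodic n f → ∑ {n} (λ i → f (suc (toℕ i))) ≃ ∑ {n} (f ∘ toℕ)
∑-rotate n f periodic = ∙-cancelˡ (f 0) _ _ (begin
  ∑ {suc n} (f ∘ toℕ)
    ≈⟨ sum-init-last {n} (f ∘ toℕ) ⟩
  ∑ {n} (λ i → f (toℕ (inject₁ i))) +ᴿ f (toℕ (fromℕ n))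
    ≈⟨ +ᴿ-cong (sum-cong-≋ {n} λ i → ℝᶜ.reflexive (cong f (Finₚ.toℕ-inject₁ i)))
         (ℝᶜ.reflexive (trans (cong f (Finₚ.toℕ-fromℕ n)) (respects periodic (∣⇒rem≡ (∣-refl {n}))))) ⟩
  ∑ {n} (f ∘ toℕ) +ᴿ f 0
    ≈⟨ ℝᶜ.+-comm (∑ {n} (f ∘ toℕ)) (f 0) ⟩
  f 0 +ᴿ ∑ {n} (f ∘ toℕ) ∎)
  where
  open ≃-Reasoning
  open GroupProperties ℝᶜ.+-group using (∙-cancelˡ)

∑-shift : ∀ n f s → Periodic n f → ∑ {n} (λ i → f (s + toℕ i)) ≃ ∑ {n} (f ∘ toℕ)
∑-shift n f zero periodic = ≃-refl
∑-shift n f (suc s) periodic = begin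
  ∑ {n} (λ i → f (suc s + toℕ i))
    ≈⟨ sum-cong-≋ {n} (λ i → ℝᶜ.reflexive (cong f (sym (ℕₚ.+-suc s (toℕ i))))) ⟩
  ∑ {n} (λ i → f (s + suc (toℕ i)))
    ≈⟨ ∑-rotate n (λ y → f (s + y)) (mkPeriodic λ {y} {z} eq →
         respects periodic (rem-+-congˡ {y} {z} s n eq)) ⟩
  ∑ {n} (λ i → f (s + toℕ i))
    ≈⟨ ∑-shift n f s periodic ⟩
  ∑ {n} (f ∘ toℕ) ∎
  where open ≃-Reasoning

-- Shifting y by a multiple of m that is x modulo p turns one residue condition into the other.
∑-coprime-residues : ∀ {m p n h} x → Coprime p m → m ∣ n → p ∣ n → Periodic m h →
  ∑ {n} (λ i → h (toℕ i) *ᴿ [ rem (toℕ i) p ≐ rem x p ])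
    ≃ ∑ {n} (λ i → h (toℕ i) *ᴿ [ rem (toℕ i) p ≐ rem 0 p ])
∑-coprime-residues {m} {p} {n} {h} x p⊥m m∣n p∣n periodic with coprime-shift p⊥m x
... | s , m∣s , s≡x = ≃-trans
  (≃-sym (∑-shift n (λ y → h y *ᴿ [ rem y p ≐ rem x p ]) s (mkPeriodic λ {y} {z} eq →
    cong₂ _*ᴿ_ (respects periodic (rem-≡-∣ m∣n eq))
               (cong (λ r → [ r ≐ rem x p ]) (rem-≡-∣ p∣n eq)))))
  (sum-cong-≋ {n} λ i → ℝᶜ.reflexive (cong₂ _*ᴿ_
    (respects periodic (trans (cong (λ k → rem k m) (ℕₚ.+-comm s (toℕ i))) (rem-+-∣ (toℕ i) m∣s)))
    (≐-cong
      (λ eq → rem-+-cancelˡ {toℕ i} {0} s p (trans eq (trans (sym s≡x) (s+0 s))))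
      (λ eq → trans (rem-+-congˡ {toℕ i} {0} s p eq) (trans (sym (s+0 s)) s≡x)))))
  where
  s+0 : ∀ s → rem s p ≡ rem (s + 0) p
  s+0 s = cong (λ k → rem k p) (sym (ℕₚ.+-identityʳ s))

module _ (z : ℕ) where
  separates coincides : ℕ → ℕ → ℝ
  separates y p = 1ᴿ +ᴿ -ᴿ [ rem z p ≐ rem y p ]
  coincides y p = -ᴿ [ rem z p ≐ rem y p ]

-- The subtracted indicator makes the sum over a full set of residues modulo `p` vanish, which puts
-- the products into the kernel. It is 0 at every `y` prime to `p`, so at units only the first
-- indicator remains.
residueDifference : ℕ → ℕ → ℕ → ℝ
residueDifference x y p = [ rem y p ≐ rem x p ] +ᴿ -ᴿ [ rem y p ≐ rem 0 p ]

∏-periodic : ∀ {m} {f : ℕ → ℕ → ℝ} ps → (∀ {y z p} → rem y p ≡ rem z p → f y p ≡ f z p) →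
             (∀ {p} → p ∈ ps → p ∣ m) → Periodic m (λ y → ∏ (f y) ps)
∏-periodic ps f-cong ∣m = mkPeriodic λ eq → ∏-cong λ p∈ → f-cong (rem-≡-∣ (∣m p∈) eq)

squareFree-∣ : ∀ {m n} → m ∣ n → SquareFree n → SquareFree m
squareFree-∣ m∣n sf (p , prime-p , p²∣m) = sf (p , prime-p , ∣-trans p²∣m m∣n)

squareFree⇒coprime : ∀ {p m} → Prime p → SquareFree (p * m) → Coprime p m
squareFree⇒coprime {p} {m} prime-p sf = prime∤⇒coprime prime-p λ p∣m → sf
  (p , prime-p , *-monoʳ-∣ p (subst (_∣ m) (sym (ℕₚ.*-identityʳ p)) p∣m))

module _ (z x : ℕ) where
  ∏coincides ∏separates ∏residues : ℕ → List ℕ → ℝ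
  ∏coincides y = ∏ (coincides z y)
  ∏separates y = ∏ (separates z y)
  ∏residues y = ∏ (residueDifference x y)

  private
    base : ∀ h → h *ᴿ ((1ᴿ +ᴿ -ᴿ 1ᴿ) *ᴿ 1ᴿ) ≃ 0ᴿ
    base h = ≗⇒≃ _ _ λ k → ℚ-solve 1 (λ h →
      h :* ((con 1ℚ :+ :- con 1ℚ) :* con 1ℚ) := con 0ℚ) refl (seq h k)

    -- Here `c` is the indicator [z ≡ y mod p], `a` and `b` are the products of `coincides` and
    -- `separates` over the remaining primes, and r - s is the factor of v_x at `p`. The identity is
    -- (1 - c) b + c a = b - c (b - a): the first part is free of `c`, the second is the same
    -- difference for fewer primes.
    split : ∀ h c a b r s v →
      h *ᴿ (((1ᴿ +ᴿ -ᴿ c) *ᴿ b +ᴿ -ᴿ (-ᴿ c *ᴿ a)) *ᴿ ((r +ᴿ -ᴿ s) *ᴿ v))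
      ≃ (h *ᴿ (b *ᴿ v) *ᴿ r +ᴿ -ᴿ (h *ᴿ (b *ᴿ v) *ᴿ s))
        +ᴿ h *ᴿ (-ᴿ c *ᴿ (r +ᴿ -ᴿ s)) *ᴿ ((b +ᴿ -ᴿ a) *ᴿ v)
    split h c a b r s v = ≗⇒≃ _ _ λ k → ℚ-solve 7 (λ h c a b r s v →
      h :* (((con 1ℚ :+ :- c) :* b :+ :- (:- c :* a)) :* ((r :+ :- s) :* v))
      := (h :* (b :* v) :* r :+ :- (h :* (b :* v) :* s))
         :+ h :* (:- c :* (r :+ :- s)) :* ((b :+ :- a) :* v)) refl
      (seq h k) (seq c k) (seq a k) (seq b k) (seq r k) (seq s k) (seq v k)

  -- Since separates = 1 + coincides, ∏separates - ∏coincides telescopes into products from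
  -- which one prime p is missing; against residueDifference x y p these sum to 0.
  ∑-telescopes≃0 : ∀ {n m h} ps → All Prime ps → n ≡ product ps * m → SquareFree n → Periodic m h →
    ∑ {n} (λ i → h (toℕ i) *ᴿ
      ((∏separates (toℕ i) ps +ᴿ -ᴿ ∏coincides (toℕ i) ps) *ᴿ ∏residues (toℕ i) ps)) ≃ 0ᴿ
  ∑-telescopes≃0 {n} {h = h} [] [] _ _ _ = ∑-zero {n} _ λ i → base (h (toℕ i))
  ∑-telescopes≃0 {n} {m} {h} (p ∷ ps) (prime-p ∷ primes) n≡ sf periodic = begin
    ∑ {n} (λ i → h (toℕ i) *ᴿ
      ((∏separates (toℕ i) (p ∷ ps) +ᴿ -ᴿ ∏coincides (toℕ i) (p ∷ ps)) *ᴿ ∏residues (toℕ i) (p ∷ ps)))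
      ≈⟨ sum-cong-≋ {n} (λ i → split (h (toℕ i)) [ rem z p ≐ rem (toℕ i) p ]
           (∏coincides (toℕ i) ps) (∏separates (toℕ i) ps)
           [ rem (toℕ i) p ≐ rem x p ] [ rem (toℕ i) p ≐ rem 0 p ] (∏residues (toℕ i) ps)) ⟩
    ∑ (λ i → (atₓ i +ᴿ -ᴿ at₀ i) +ᴿ rest i)
      ≈⟨ ∑-distrib-+ (λ i → atₓ i +ᴿ -ᴿ at₀ i) rest ⟩
    ∑ (λ i → atₓ i +ᴿ -ᴿ at₀ i) +ᴿ ∑ rest
      ≈⟨ +ᴿ-cong (∑-distrib-+ atₓ (λ i → -ᴿ at₀ i)) rest≃0 ⟩
    (∑ atₓ +ᴿ ∑ (λ i → -ᴿ at₀ i)) +ᴿ 0ᴿ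
      ≈⟨ ℝᶜ.+-identityʳ _ ⟩
    ∑ atₓ +ᴿ ∑ (λ i → -ᴿ at₀ i)
      -- The weight `h′` no longer involves `p`: it has period q = n/p, which is prime to `p` as `n`
      -- is square-free.
      ≈⟨ ℝᶜ.+-congʳ (∑-coprime-residues x p⊥ q∣n p∣n h′-periodic) ⟩
    ∑ at₀ +ᴿ ∑ (λ i → -ᴿ at₀ i)
      ≈⟨ ∑-distrib-+ at₀ (λ i → -ᴿ at₀ i) ⟨
    ∑ (λ i → at₀ i +ᴿ -ᴿ at₀ i)
      ≈⟨ ∑-zero _ (λ i → ℝᶜ.-‿inverseʳ (at₀ i)) ⟩
    0ᴿ ∎
    where
    open ≃-Reasoning
    q : ℕ
    q = product ps * m
    n≡pq : n ≡ p * q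
    n≡pq = trans n≡ (ℕₚ.*-assoc p (product ps) m)
    p⊥ : Coprime p q
    p⊥ = squareFree⇒coprime prime-p (subst SquareFree n≡pq sf)
    q∣n : q ∣ n
    q∣n = subst (q ∣_) (sym n≡pq) (n∣m*n p)
    p∣n : p ∣ n
    p∣n = subst (p ∣_) (sym n≡pq) (m∣m*n q)
    h′ : ℕ → ℝ
    h′ y = h y *ᴿ (∏separates y ps *ᴿ ∏residues y ps)
    ps∣q : ∀ {r} → r ∈ ps → r ∣ q
    ps∣q r∈ = ∣-trans (∈⇒∣product r∈) (m∣m*n m)
    h′-periodic : Periodic q h′
    h′-periodic = mkPeriodic λ eq → cong₂ _*ᴿ_
      (respects periodic (rem-≡-∣ (n∣m*n (product ps)) eq))
      (cong₂ _*ᴿ_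
        (respects (∏-periodic {f = separates z} ps
          (λ {_} {_} {p} → cong (λ r → 1ᴿ +ᴿ -ᴿ [ rem z p ≐ r ])) ps∣q) eq)
        (respects (∏-periodic {f = residueDifference x} ps
          (λ {_} {_} {p} → cong (λ r → [ r ≐ rem x p ] +ᴿ -ᴿ [ r ≐ rem 0 p ])) ps∣q) eq))
    atₓ at₀ rest : Fin n → ℝ
    atₓ i = h′ (toℕ i) *ᴿ [ rem (toℕ i) p ≐ rem x p ]
    at₀ i = h′ (toℕ i) *ᴿ [ rem (toℕ i) p ≐ rem 0 p ]
    -- This is why the weight `h` is arbitrary: the factors at `p` move into it and its period grows
    -- from `m` to `p * m`, while the range of summation stays `n`.
    h″ : ℕ → ℝ
    h″ y = h y *ᴿ (coincides z y p *ᴿ residueDifference x y p)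
    rest i = h″ (toℕ i) *ᴿ ((∏separates (toℕ i) ps +ᴿ -ᴿ ∏coincides (toℕ i) ps) *ᴿ ∏residues (toℕ i) ps)
    rest≃0 : ∑ rest ≃ 0ᴿ
    rest≃0 = ∑-telescopes≃0 {m = p * m} {h = h″} ps primes
      (trans n≡pq (trans (sym (ℕₚ.*-assoc p (product ps) m))
        (trans (cong (_* m) (ℕₚ.*-comm p (product ps))) (ℕₚ.*-assoc (product ps) p m))))
      sf (mkPeriodic λ eq → cong₂ _*ᴿ_ (respects periodic (rem-≡-∣ (n∣m*n p) eq))
        (cong (λ r → -ᴿ [ rem z p ≐ r ] *ᴿ ([ r ≐ rem x p ] +ᴿ -ᴿ [ r ≐ rem 0 p ]))
          (rem-≡-∣ {p} (m∣m*n m) eq)))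

-- Residues modulo all prime factors determine the number

coprime-*-∣ : ∀ {m n t} → Coprime m n → m ∣ t → n ∣ t → m * n ∣ t
coprime-*-∣ {m} {n} m⊥n (divides q refl) n∣qm =
  subst (m * n ∣_) (ℕₚ.*-comm m q)
    (*-monoʳ-∣ m (coprime-divisor (Coprime.sym m⊥n) (subst (n ∣_) (ℕₚ.*-comm q m) n∣qm)))

product-∣ : ∀ {t ps} → All Prime ps → SquareFree (product ps) → All (_∣ t) ps → product ps ∣ t
product-∣ {t} [] _ _ = 1∣ t
product-∣ {ps = p ∷ ps} (prime-p ∷ primes) sf (p∣t ∷ ps∣t) =
  coprime-*-∣ (squareFree⇒coprime prime-p sf) p∣t
    (product-∣ primes (squareFree-∣ (n∣m*n p) sf) ps∣t)

module _ {ps} (primes : All Prime ps) (sf : SquareFree (product ps)) where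
  rem-≡-product-≤ : ∀ {i j} → i ≤ j → All (λ p → rem j p ≡ rem i p) ps →
                    rem j (product ps) ≡ rem i (product ps)
  rem-≡-product-≤ {i} i≤j j≡i with ℕₚ.m≤n⇒∃[o]m+o≡n i≤j
  ... | t , refl = rem-+-∣ i (product-∣ primes sf (All.map (rem≡⇒∣ i t) j≡i))

  rem-≡-product : ∀ {i j} → All (λ p → rem i p ≡ rem j p) ps → rem i (product ps) ≡ rem j (product ps)
  rem-≡-product {i} {j} i≡j with ℕₚ.≤-total i j
  ... | inj₁ i≤j = sym (rem-≡-product-≤ i≤j (All.map sym i≡j))
  ... | inj₂ j≤i = rem-≡-product-≤ j≤i i≡j

  differing-residue : ∀ {i j} → i < product ps → j < product ps → i ≢ j →
                      Any (λ p → rem i p ≢ rem j p) ps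
  differing-residue {i} {j} i< j< i≢j =
    Allₚ.¬All⇒Any¬ (λ p → rem i p ℕₚ.≟ rem j p) ps λ i≡j → i≢j
      (trans (sym (rem-< i<)) (trans (rem-≡-product i≡j) (rem-< j<)))

∑-pick : ∀ {n c} (f : ℕ → ℝ) → c < n → ∑ {n} (λ i → f (toℕ i) *ᴿ [ toℕ i ≐ c ]) ≃ f c
∑-pick {n} {c} f c<n = begin
  ∑ {n} (λ i → f (toℕ i) *ᴿ [ toℕ i ≐ c ])
    ≈⟨ ∑-single {n} (λ i → f (toℕ i) *ᴿ [ toℕ i ≐ c ]) (fromℕ< c<n) (λ j j≢c → ≃-trans
         (ℝᶜ.*-congˡ {f (toℕ j)} (ℝᶜ.reflexive (≐-no λ j≡c → j≢c
           (Finₚ.toℕ-injective (trans j≡c (sym (Finₚ.toℕ-fromℕ< c<n)))))))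
         (ℝᶜ.zeroʳ (f (toℕ j)))) ⟩
  f (toℕ (fromℕ< c<n)) *ᴿ [ toℕ (fromℕ< c<n) ≐ c ]
    ≡⟨ cong₂ _*ᴿ_ (cong f (Finₚ.toℕ-fromℕ< c<n)) (≐-yes (Finₚ.toℕ-fromℕ< c<n)) ⟩
  f c *ᴿ 1ᴿ
    ≈⟨ ℝᶜ.*-identityʳ (f c) ⟩
  f c ∎
  where open ≃-Reasoning

-0≃0 : -ᴿ 0ᴿ ≃ 0ᴿ
-0≃0 = GroupProperties.ε⁻¹≈ε ℝᶜ.+-group

x-0≃x : ∀ x → x +ᴿ -ᴿ 0ᴿ ≃ x
x-0≃x x = ≃-trans (ℝᶜ.+-congˡ {x} -0≃0) (ℝᶜ.+-identityʳ x)

-- The two matrices and their kernel vectors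

module _ {n : ℕ} (F : PrimeFactorisation n) where
  open PrimeFactorisation F renaming (factors to ps)

  -- `ps` lists the primes with multiplicity; repetition does not change `adjacencyMatrix`, whose
  -- factors are 0 or 1.
  adjacencyMatrix differenceMatrix : Matrix n
  adjacencyMatrix i j = ∏ (separates (toℕ i) (toℕ j)) ps
  differenceMatrix i j = adjacencyMatrix i j +ᴿ -ᴿ ∏ (coincides (toℕ i) (toℕ j)) ps

  factors-∣ : ∀ {p} → p ∈ ps → p ∣ n
  factors-∣ p∈ = subst (_ ∣_) (sym isFactorisation) (∈⇒∣product p∈)

  module _ (sf : SquareFree n) where
    private
      differing : ∀ {i j} → i < n → j < n → i ≢ j → Any (λ p → rem i p ≢ rem j p) ps
      differing i< j< = differing-residue factorsPrime (subst SquareFree isFactorisation sf)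
        (subst (_ <_) isFactorisation i<) (subst (_ <_) isFactorisation j<)

    -- Distinct i, j < n differ modulo some prime factor of a square-free `n`, and that factor
    -- annihilates the subtracted product.
    differenceMatrix-off-diagonal : ∀ {i j} → i ≢ j → differenceMatrix i j ≃ adjacencyMatrix i j
    differenceMatrix-off-diagonal {i} {j} i≢j = begin
      adjacencyMatrix i j +ᴿ -ᴿ ∏ (coincides (toℕ i) (toℕ j)) ps
        ≈⟨ ℝᶜ.+-congˡ (-ᴿ-cong (∏-zero (Any.map (λ ne → ≃-trans (-ᴿ-cong (ℝᶜ.reflexive (≐-no ne))) -0≃0)
             (differing (Finₚ.toℕ<n i) (Finₚ.toℕ<n j) (i≢j ∘ Finₚ.toℕ-injective))))) ⟩
      adjacencyMatrix i j +ᴿ -ᴿ 0ᴿ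
        ≈⟨ x-0≃x _ ⟩
      adjacencyMatrix i j ∎
      where open ≃-Reasoning

    unitEchelon : 2 ≤ n → EchelonKernel differenceMatrix (φ n)
    unitEchelon 2≤n = record
      { vector     = λ j i → ∏ (residueDifference (unit j) (toℕ i)) ps
      ; inside     = λ j i → ≃-trans
          (sum-cong-≋ {n} λ l → ≃-sym (ℝᶜ.*-identityˡ _))
          -- The telescoping sum is started with the constant weight 1, of period 1.
          (∑-telescopes≃0 (toℕ i) (unit j) {n} {1} {λ _ → 1ᴿ} ps factorsPrime
            (trans isFactorisation (sym (ℕₚ.*-identityʳ _))) sf (mkPeriodic λ _ → refl))
      ; pivot      = λ j → fromℕ< (unit<n j)
      ; pivot-one  = λ j → ∏-one (All.tabulate λ p∈ →
          ≃-trans (at-pivot j j p∈) (ℝᶜ.reflexive (≐-yes refl)))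
      ; pivot-zero = λ {i} {j} i≢j → ∏-zero (restrict (λ p∈ ne →
          ≃-trans (at-pivot i j p∈) (ℝᶜ.reflexive (≐-no ne)))
          (differing (unit<n i) (unit<n j) (i≢j ∘ lookup-injective (units-unique n))))
      }
      where
      unit : Fin (φ n) → ℕ
      unit = lookup (units n)
      -- `units n` ranges up to `n` inclusive, but `n` itself is coprime to `n` only for n = 1, so
      -- units are valid indices.
      unit<n : ∀ j → unit j < n
      unit<n j with ∈-units⁻ {n = n} (∈-lookup {xs = units n} j)
      ... | _ , u≤n , u⊥n = ℕₚ.≤∧≢⇒< u≤n λ u≡n →
        ℕₚ.<⇒≢ 2≤n (sym (u⊥n (subst (n ∣_) (sym u≡n) ∣-refl , ∣-refl)))
      at-pivot : ∀ i j {p} → p ∈ ps → residueDifference (unit j) (toℕ (fromℕ< (unit<n i))) p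
                 ≃ [ rem (unit i) p ≐ rem (unit j) p ]
      at-pivot i j {p} p∈ = begin
        residueDifference (unit j) (toℕ (fromℕ< (unit<n i))) p
          ≡⟨ cong (λ y → residueDifference (unit j) y p) (Finₚ.toℕ-fromℕ< (unit<n i)) ⟩
        [ rem (unit i) p ≐ rem (unit j) p ] +ᴿ -ᴿ [ rem (unit i) p ≐ rem 0 p ]
          ≡⟨ cong (λ x → [ rem (unit i) p ≐ rem (unit j) p ] +ᴿ -ᴿ x)
               (≐-no λ eq → p∤unit (rem≡⇒∣ 0 (unit i) eq)) ⟩
        [ rem (unit i) p ≐ rem (unit j) p ] +ᴿ -ᴿ 0ᴿ
          ≈⟨ x-0≃x _ ⟩
        [ rem (unit i) p ≐ rem (unit j) p ] ∎
        where
        open ≃-Reasoning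
        p∤unit : ¬ p ∣ unit i
        p∤unit = coprime⇒prime∤ (All.lookup factorsPrime p∈)
          (proj₂ (proj₂ (∈-units⁻ {n = n} (∈-lookup {xs = units n} i)))) (factors-∣ p∈)
      restrict : ∀ {P Q : ℕ → Set} {qs} → (∀ {p} → p ∈ qs → P p → Q p) → Any P qs → Any Q qs
      restrict f (here px)   = here (f (here refl) px)
      restrict f (there any) = there (restrict (f ∘ there) any)

  adjacencyMatrix-periodic : ∀ z (r : Radical n) → Periodic (Radical.radical r) (λ y → ∏ (separates z y) ps)
  adjacencyMatrix-periodic z r = ∏-periodic {f = separates z} ps
    (λ {_} {_} {p} → cong (λ k → 1ᴿ +ᴿ -ᴿ [ rem z p ≐ k ]))
    λ p∈ → Radical.primes-∣ r (All.lookup factorsPrime p∈) (factors-∣ p∈)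

  -- The vectors are e_{m+j} - e_{j mod m}: the two columns they compare agree, as the indices are
  -- congruent modulo the radical `m`. The pivots m + j lie at or above `m` and the other indices
  -- below it, so they never meet.
  radicalEchelon : .{{NonZero n}} → (r : Radical n) → ∀ {k} → n ≡ Radical.radical r + k →
                   EchelonKernel adjacencyMatrix k
  radicalEchelon r {k} n≡m+k = record
    { vector     = λ j i → [ toℕ i ≐ m + toℕ j ] +ᴿ -ᴿ [ toℕ i ≐ rem (toℕ j) m ]
    ; inside     = λ j i → begin
        ∑ {n} (λ l → adjacencyMatrix i l *ᴿ ([ toℕ l ≐ m + toℕ j ] +ᴿ -ᴿ [ toℕ l ≐ rem (toℕ j) m ]))
          ≈⟨ sum-cong-≋ {n} (λ l → distribute (adjacencyMatrix i l) [ toℕ l ≐ m + toℕ j ]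
               [ toℕ l ≐ rem (toℕ j) m ]) ⟩
        ∑ {n} (λ l → adjacencyMatrix i l *ᴿ [ toℕ l ≐ m + toℕ j ]
                 +ᴿ -ᴿ 1ᴿ *ᴿ (adjacencyMatrix i l *ᴿ [ toℕ l ≐ rem (toℕ j) m ]))
          ≈⟨ ∑-distrib-+ {n} (λ l → adjacencyMatrix i l *ᴿ [ toℕ l ≐ m + toℕ j ])
               (λ l → -ᴿ 1ᴿ *ᴿ (adjacencyMatrix i l *ᴿ [ toℕ l ≐ rem (toℕ j) m ])) ⟩
        ∑ {n} (λ l → adjacencyMatrix i l *ᴿ [ toℕ l ≐ m + toℕ j ])
          +ᴿ ∑ {n} (λ l → -ᴿ 1ᴿ *ᴿ (adjacencyMatrix i l *ᴿ [ toℕ l ≐ rem (toℕ j) m ]))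
          ≈⟨ +ᴿ-cong (∑-pick (column i) (m+j<n j))
               (≃-trans
                 (≃-sym (*-distribˡ-sum {n} (-ᴿ 1ᴿ)
                   (λ l → adjacencyMatrix i l *ᴿ [ toℕ l ≐ rem (toℕ j) m ])))
                 (ℝᶜ.*-congˡ { -ᴿ 1ᴿ} (∑-pick (column i)
                   (ℕₚ.<-≤-trans (residue<m (toℕ j)) (ℕₚ.≤-trans (ℕₚ.m≤m+n m _) (ℕₚ.<⇒≤ (m+j<n j))))))) ⟩
        column i (m + toℕ j) +ᴿ -ᴿ 1ᴿ *ᴿ column i (rem (toℕ j) m)
          ≡⟨ cong (λ x → column i (m + toℕ j) +ᴿ -ᴿ 1ᴿ *ᴿ x)
               (respects (adjacencyMatrix-periodic (toℕ i) r) (trans (rem-< (residue<m (toℕ j)))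
                 (sym (trans (cong (λ y → rem y m) (ℕₚ.+-comm m (toℕ j)))
                             (rem-+-∣ (toℕ j) {m} ∣-refl))))) ⟩
        column i (m + toℕ j) +ᴿ -ᴿ 1ᴿ *ᴿ column i (m + toℕ j)
          ≈⟨ cancel (column i (m + toℕ j)) ⟩
        0ᴿ ∎
    ; pivot      = λ j → fromℕ< (m+j<n j)
    ; pivot-one  = λ j → ≃-trans (at-pivot j j) (ℝᶜ.reflexive (≐-yes refl))
    ; pivot-zero = λ {i} {j} i≢j → ≃-trans (at-pivot i j) (ℝᶜ.reflexive
        (≐-no (i≢j ∘ Finₚ.toℕ-injective ∘ ℕₚ.+-cancelˡ-≡ m _ _)))
    }
    where
    open ≃-Reasoning
    open Radical r renaming (radical to m)
    m+j<n : ∀ (j : Fin k) → m + toℕ j < n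
    m+j<n j = subst (m + toℕ j <_) (sym n≡m+k) (ℕₚ.+-monoʳ-< m (Finₚ.toℕ<n j))
    m≢0 : NonZero m
    m≢0 = ℕ.≢-nonZero λ m≡0 → ℕ.≢-nonZero⁻¹ n (0∣⇒≡0 (subst (_∣ n) m≡0 radical-∣))
    residue<m : ∀ i → rem i m < m
    residue<m i = subst (_< m) (sym (rem≡% i m {{m≢0}})) (m%n<n i m {{m≢0}})
    at-pivot : ∀ (i j : Fin k) →
      [ toℕ (fromℕ< (m+j<n i)) ≐ m + toℕ j ] +ᴿ -ᴿ [ toℕ (fromℕ< (m+j<n i)) ≐ rem (toℕ j) m ]
      ≃ [ m + toℕ i ≐ m + toℕ j ]
    at-pivot i j = begin
      [ toℕ (fromℕ< (m+j<n i)) ≐ m + toℕ j ] +ᴿ -ᴿ [ toℕ (fromℕ< (m+j<n i)) ≐ rem (toℕ j) m ]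
        ≡⟨ cong (λ y → [ y ≐ m + toℕ j ] +ᴿ -ᴿ [ y ≐ rem (toℕ j) m ]) (Finₚ.toℕ-fromℕ< (m+j<n i)) ⟩
      [ m + toℕ i ≐ m + toℕ j ] +ᴿ -ᴿ [ m + toℕ i ≐ rem (toℕ j) m ]
        ≡⟨ cong (λ x → [ m + toℕ i ≐ m + toℕ j ] +ᴿ -ᴿ x)
             (≐-no (ℕₚ.<⇒≢ (ℕₚ.<-≤-trans (residue<m (toℕ j)) (ℕₚ.m≤m+n m _)) ∘ sym)) ⟩
      [ m + toℕ i ≐ m + toℕ j ] +ᴿ -ᴿ 0ᴿ
        ≈⟨ x-0≃x _ ⟩
      [ m + toℕ i ≐ m + toℕ j ] ∎
    column : Fin n → ℕ → ℝ
    column i y = ∏ (separates (toℕ i) y) ps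
    distribute : ∀ a v w → a *ᴿ (v +ᴿ -ᴿ w) ≃ a *ᴿ v +ᴿ -ᴿ 1ᴿ *ᴿ (a *ᴿ w)
    distribute a v w = ≗⇒≃ _ _ λ k → ℚ-solve 3 (λ a v w →
      a :* (v :+ :- w) := a :* v :+ :- con 1ℚ :* (a :* w)) refl (seq a k) (seq v k) (seq w k)
    cancel : ∀ a → a +ᴿ -ᴿ 1ᴿ *ᴿ a ≃ 0ᴿ
    cancel a = ≗⇒≃ _ _ λ k → ℚ-solve 1 (λ a → a :+ :- con 1ℚ :* a := con 0ℚ) refl (seq a k)

permuteEchelon : ∀ {n k} {A : Matrix n} (σ : Permutation n n) → EchelonKernel A k →
                 EchelonKernel (λ i j → A (σ ⟨$⟩ʳ i) (σ ⟨$⟩ʳ j)) k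
permuteEchelon {A = A} σ E = record
  { vector     = λ j i → vector j (σ ⟨$⟩ʳ i)
  ; inside     = λ j i → ≃-trans
      (≃-sym (sum-permute (λ l → A (σ ⟨$⟩ʳ i) l *ᴿ vector j l) σ)) (inside j (σ ⟨$⟩ʳ i))
  ; pivot      = λ j → σ ⟨$⟩ˡ pivot j
  ; pivot-one  = λ j → subst (λ i → vector j i ≃ 1ᴿ) (sym (Permutation.inverseʳ σ)) (pivot-one j)
  ; pivot-zero = λ {i} {j} i≢j → subst (λ l → vector j l ≃ 0ᴿ) (sym (Permutation.inverseʳ σ)) (pivot-zero i≢j)
  }
  where open EchelonKernel E

module _ {n} (F : PrimeFactorisation n) where
  open PrimeFactorisation F renaming (factors to ps)

  adjacencyMatrix-symmetric : ∀ i j → adjacencyMatrix F i j ≡ adjacencyMatrix F j i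
  adjacencyMatrix-symmetric i j = ∏-cong λ {p} _ →
    cong (λ x → 1ᴿ +ᴿ -ᴿ x) (≐-sym (rem (toℕ i) p) (rem (toℕ j) p))

  -- Every factor is 0 or 1 according to a decidable condition on residues, so the nonvanishing of
  -- this real number has a purely arithmetical form.
  adjacencyMatrix-nonzero : ∀ i j → (¬ adjacencyMatrix F i j ≃ 0ᴿ) ⇔
                            All (λ p → rem (toℕ i) p ≢ rem (toℕ j) p) ps
  adjacencyMatrix-nonzero i j = mk⇔ to from
    where
    to : ¬ adjacencyMatrix F i j ≃ 0ᴿ → All (λ p → rem (toℕ i) p ≢ rem (toℕ j) p) ps
    to ≄0 = Allₚ.¬Any⇒All¬ ps λ equal → ≄0 (∏-zero (Any.map
      (λ eq → ≃-trans (ℝᶜ.reflexive (cong (λ x → 1ᴿ +ᴿ -ᴿ x) (≐-yes eq))) (ℝᶜ.-‿inverseʳ 1ᴿ)) equal))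
    from : All (λ p → rem (toℕ i) p ≢ rem (toℕ j) p) ps → ¬ adjacencyMatrix F i j ≃ 0ᴿ
    from differ ≃0 = 1≄0 (≃-trans (≃-sym (∏-one (All.map
      (λ ne → ≃-trans (ℝᶜ.reflexive (cong (λ x → 1ᴿ +ᴿ -ᴿ x) (≐-no ne))) (x-0≃x 1ᴿ)) differ))) ≃0)

  -- The `t` in question is i - j modulo `n`, and it is a unit exactly when no prime factor of `n`
  -- divides i - j.
  residues⇔unit : 2 ≤ n → ∀ (i j : Fin n) →
    (∃ λ t → B 1 n t × rem (toℕ i) n ≡ rem (t + toℕ j) n)
      ⇔ All (λ p → rem (toℕ i) p ≢ rem (toℕ j) p) ps
  residues⇔unit 2≤n i j = mk⇔ to from
    where
    to : (∃ λ t → B 1 n t × rem (toℕ i) n ≡ rem (t + toℕ j) n) →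
         All (λ p → rem (toℕ i) p ≢ rem (toℕ j) p) ps
    to (t , (_ , _ , gcd≡1) , i≡t+j) = All.tabulate λ {p} p∈ i≡j →
      coprime⇒prime∤ (All.lookup factorsPrime p∈) (gcd≡1⇒coprime gcd≡1) (factors-∣ F p∈)
        (rem≡⇒∣ (toℕ j) t (trans (cong (λ k → rem k p) (ℕₚ.+-comm (toℕ j) t))
          (trans (sym (rem-≡-∣ (factors-∣ F p∈) i≡t+j)) i≡j)))
    from : All (λ p → rem (toℕ i) p ≢ rem (toℕ j) p) ps →
           ∃ λ t → B 1 n t × rem (toℕ i) n ≡ rem (t + toℕ j) n
    from differ = t , (ℕₚ.n≢0⇒n>0 t≢0 , ℕₚ.<⇒≤ t<n , coprime⇒gcd≡1 t⊥n) , sym t+j≡i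
      where
      instance
        n≢0 : NonZero n
        n≢0 = ℕ.>-nonZero (ℕₚ.≤-trans (s≤s z≤n) 2≤n)
      t : ℕ
      -- i - j modulo `n`, with `n` added before subtracting because ℕ truncates.
      t = rem (toℕ i + (n ∸ toℕ j)) n
      t<n : t < n
      t<n = subst (_< n) (sym (rem≡% _ n)) (m%n<n _ n)
      t+j≡i : rem (t + toℕ j) n ≡ rem (toℕ i) n
      t+j≡i = begin
        rem (t + toℕ j) n
          ≡⟨ cong (λ k → rem k n) (ℕₚ.+-comm t (toℕ j)) ⟩
        rem (toℕ j + t) n
          ≡⟨ rem-+-congˡ (toℕ j) n (rem-< t<n) ⟩
        rem (toℕ j + (toℕ i + (n ∸ toℕ j))) n
          ≡⟨ cong (λ k → rem k n) (trans (ℕₚ.+-comm (toℕ j) _) (trans (ℕₚ.+-assoc (toℕ i) _ _)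
               (cong (λ k → toℕ i + k) (ℕₚ.m∸n+n≡m (ℕₚ.<⇒≤ (Finₚ.toℕ<n j)))))) ⟩
        rem (toℕ i + n) n
          ≡⟨ rem-+-∣ (toℕ i) {n} ∣-refl ⟩
        rem (toℕ i) n ∎
        where open ≡-Reasoning
      t⊥n : Coprime t n
      t⊥n = noCommonPrime⇒coprime λ {p} prime-p p∣t p∣n →
        All.lookup differ
          (factorisationHasAllPrimeFactors prime-p (subst (p ∣_) isFactorisation p∣n) factorsPrime)
          (trans (sym (rem-≡-∣ p∣n t+j≡i))
            (trans (cong (λ k → rem k p) (ℕₚ.+-comm t (toℕ j))) (rem-+-∣ (toℕ j) p∣t)))
      t≢0 : t ≢ 0
      t≢0 t≡0 = ℕₚ.<⇒≢ 2≤n (sym (Coprime.0-coprimeTo-m⇒m≡1 (subst (λ k → Coprime k n) t≡0 t⊥n)))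

-- Cayley graphs of cyclic groups

module _ {c ℓ} (G : Group c ℓ) (n : ℕ) (2≤n : 2 ≤ n)
         (u : Enumeration n (Group.setoid G))
         (a : Group.Carrier G) (gen : Generates G a) where
  open Group G using (Carrier; _≈_; _∙_; _⁻¹; ε; setoid; identityʳ; monoid; ∙-congˡ; ∙-congʳ)
    renaming (refl to ≈-refl; sym to ≈-sym; trans to ≈-trans; reflexive to ≈-reflexive)
  open GroupProperties G using (inverseʳ-unique; ∙-cancelˡ; x≈z//y; //-rightDividesˡ)
  open MonoidMult monoid using (×-homo-+)
  open Inverse u using () renaming (to to element; from to index; from-cong to index-cong;
    strictlyInverseˡ to element-index; strictlyInverseʳ to index-element)
  open SetoidReasoning setoid

  private
    instance
      n≢0 : NonZero n
      n≢0 = ℕ.>-nonZero (ℕₚ.≤-trans (s≤s z≤n) 2≤n)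

    infixr 8 a^_
    a^_ : ℕ → Carrier
    a^ k = _^ᴺ_ G a k

  power-multiple : ∀ k → a^ (k * n) ≈ ε
  power-multiple zero = ≈-refl
  power-multiple (suc k) = begin
    a^ (n + k * n)        ≈⟨ ×-homo-+ a n (k * n) ⟩
    a^ n ∙ a^ (k * n)     ≈⟨ ∙-congʳ (a^n≈ε G n 2≤n u a gen) ⟩
    ε ∙ a^ (k * n)        ≈⟨ ∙-congˡ (power-multiple k) ⟩
    ε ∙ ε                 ≈⟨ identityʳ ε ⟩
    ε                     ∎

  power-rem : ∀ i → a^ i ≈ a^ rem i n
  power-rem i = begin
    a^ i                              ≡⟨ cong a^_ (m≡m%n+[m/n]*n i n) ⟩
    a^ (i % n + i / n * n)            ≈⟨ ×-homo-+ a (i % n) (i / n * n) ⟩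
    a^ (i % n) ∙ a^ (i / n * n)       ≈⟨ ∙-congˡ (power-multiple (i / n)) ⟩
    a^ (i % n) ∙ ε                    ≈⟨ identityʳ _ ⟩
    a^ (i % n)                        ≡⟨ cong a^_ (rem≡% i n) ⟨
    a^ rem i n                        ∎

  power-injective-≤ : ∀ {i j} → i ≤ j → j < n → a^ i ≈ a^ j → i ≡ j
  power-injective-≤ {i} i≤j j<n eq with ℕₚ.m≤n⇒∃[o]m+o≡n i≤j
  ... | zero , refl = sym (ℕₚ.+-identityʳ i)
  ... | t@(suc _) , refl = contradiction
    (a^k≈ε⇒n≤k G n 2≤n u a gen t (s≤s z≤n) (∙-cancelˡ (a^ i) (a^ t) ε (begin
      a^ i ∙ a^ t   ≈⟨ ×-homo-+ a i t ⟨
      a^ (i + t)    ≈⟨ eq ⟨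
      a^ i          ≈⟨ identityʳ _ ⟨
      a^ i ∙ ε      ∎)))
    (ℕₚ.<⇒≱ (ℕₚ.≤-<-trans (ℕₚ.m≤n+m t i) j<n))

  power-injective : ∀ {i j} → i < n → j < n → a^ i ≈ a^ j → i ≡ j
  power-injective {i} {j} i<n j<n eq with ℕₚ.≤-total i j
  ... | inj₁ i≤j = power-injective-≤ i≤j j<n eq
  ... | inj₂ j≤i = sym (power-injective-≤ j≤i i<n (≈-sym eq))

  rem-<-n : ∀ i → rem i n < n
  rem-<-n i = subst (_< n) (sym (rem≡% i n)) (m%n<n i n)

  power⇒rem : ∀ {i j} → a^ i ≈ a^ j → rem i n ≡ rem j n
  power⇒rem {i} {j} eq = power-injective (rem-<-n i) (rem-<-n j)
    (≈-trans (≈-sym (power-rem i)) (≈-trans eq (power-rem j)))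

  rem⇒power : ∀ {i j} → rem i n ≡ rem j n → a^ i ≈ a^ j
  rem⇒power {i} {j} eq = ≈-trans (power-rem i)
    (≈-trans (≈-reflexive (cong a^_ eq)) (≈-sym (power-rem j)))

  power-surjective : ∀ g → ∃ λ k → g ≈ a^ k
  power-surjective g with gen g
  ... | ℤ.+ k , g≈ = k , g≈
  -- The exponent -(k + 1) is replaced by (k + 1)(n - 1), which is congruent to it modulo `n`.
  ... | ℤ.-[1+ k ] , g≈ = suc k * ℕ.pred n , ≈-trans g≈ (≈-sym (inverseʳ-unique _ _ (begin
    a^ suc k ∙ a^ (suc k * ℕ.pred n)   ≈⟨ ×-homo-+ a (suc k) (suc k * ℕ.pred n) ⟨
    a^ (suc k + suc k * ℕ.pred n)      ≡⟨ cong a^_ (ℕₚ.*-suc (suc k) (ℕ.pred n)) ⟨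
    a^ (suc k * suc (ℕ.pred n))        ≡⟨ cong (λ m → a^ (suc k * m)) (ℕₚ.suc-pred n) ⟩
    a^ (suc k * n)                     ≈⟨ power-multiple (suc k) ⟩
    ε                                  ∎)))

  exponent : Fin n → Fin n
  exponent i = fromℕ< (rem-<-n (proj₁ (power-surjective (element i))))

  element≈ : ∀ i → element i ≈ a^ toℕ (exponent i)
  element≈ i = begin
    element i           ≈⟨ proj₂ (power-surjective (element i)) ⟩
    a^ k                ≈⟨ power-rem k ⟩
    a^ rem k n          ≡⟨ cong a^_ (Finₚ.toℕ-fromℕ< (rem-<-n k)) ⟨
    a^ toℕ (exponent i) ∎
    where
    k : ℕ
    k = proj₁ (power-surjective (element i))

  -- The enumeration `u` may list the group in any order; this permutation sends each index to its
  -- discrete logarithm, and `permuteEchelon` transports kernels along it.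
  exponents : Permutation n n
  exponents = permutation exponent (λ j → index (a^ toℕ j))
    (λ j → Finₚ.toℕ-injective (power-injective (Finₚ.toℕ<n _) (Finₚ.toℕ<n j)
      (≈-trans (≈-sym (element≈ _)) (element-index (a^ toℕ j)))))
    (λ i → trans (index-cong (≈-sym (element≈ i))) (index-element i))

  private
    Γ : SimpleGraph setoid ℓ
    Γ = cayleyGraph G (unitPowers G n 2≤n u a gen)
    open SimpleGraph Γ using (Adjacent)

  adjacent⇔unit : ∀ i j → Adjacent (element i) (element j) ⇔
    (∃ λ t → B 1 n t × rem (toℕ (exponent i)) n ≡ rem (t + toℕ (exponent j)) n)
  adjacent⇔unit i j = mk⇔
    (λ (t , t∈B , eq) → t , t∈B , power⇒rem (begin
      a^ toℕ (exponent i)                   ≈⟨ element≈ i ⟨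
      element i                             ≈⟨ //-rightDividesˡ (element j) (element i) ⟨
      element i ∙ element j ⁻¹ ∙ element j  ≈⟨ ∙-congʳ eq ⟩
      a^ t ∙ element j                      ≈⟨ ∙-congˡ (element≈ j) ⟩
      a^ t ∙ a^ toℕ (exponent j)            ≈⟨ ×-homo-+ a t (toℕ (exponent j)) ⟨
      a^ (t + toℕ (exponent j))             ∎))
    (λ (t , t∈B , eq) → t , t∈B , ≈-sym (x≈z//y _ _ _ (begin
      a^ t ∙ element j                      ≈⟨ ∙-congˡ (element≈ j) ⟩
      a^ t ∙ a^ toℕ (exponent j)            ≈⟨ ×-homo-+ a t (toℕ (exponent j)) ⟨
      a^ (t + toℕ (exponent j))             ≈⟨ rem⇒power eq ⟨
      a^ toℕ (exponent i)                   ≈⟨ element≈ i ⟨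
      element i                             ∎)))

  -- `Pattern` leaves the diagonal free, so agreement off the diagonal is enough and both matrices
  -- qualify.
  cayleyPattern : (F : PrimeFactorisation n) (A : Matrix n) →
                  (∀ {i j} → i ≢ j → A i j ≃ adjacencyMatrix F i j) →
                  Pattern u Γ (λ i j → A (exponent i) (exponent j))
  cayleyPattern F A off-diagonal = record
    { symmetricMatrix  = λ i j → symmetric (exponent i) (exponent j)
    ; nonzero⇔adjacent = λ {i} {j} i≢j →
        let A≃ = off-diagonal (i≢j ∘ exponent-injective)
            nonzero = adjacencyMatrix-nonzero F (exponent i) (exponent j)
            residues = residues⇔unit F 2≤n (exponent i) (exponent j)
            adjacent = adjacent⇔unit i j
        in mk⇔
          (λ A≄0 → Equivalence.from adjacent (Equivalence.from residues
            (Equivalence.to nonzero (λ ≃0 → A≄0 (≃-trans A≃ ≃0)))))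
          (λ adj ≃0 → Equivalence.from nonzero
            (Equivalence.to residues (Equivalence.to adjacent adj))
            (≃-trans (≃-sym A≃) ≃0))
    }
    where
    exponent-injective : ∀ {i j} → exponent i ≡ exponent j → i ≡ j
    exponent-injective {i} {j} eq = trans (sym (Permutation.inverseˡ exponents))
      (trans (cong (exponents ⟨$⟩ˡ_) eq) (Permutation.inverseˡ exponents))
    symmetric : ∀ i j → A i j ≃ A j i
    symmetric i j with i Finₚ.≟ j
    ... | yes refl = ≃-refl
    ... | no i≢j = ≃-trans (off-diagonal i≢j)
      (≃-trans (ℝᶜ.reflexive (adjacencyMatrix-symmetric F i j)) (≃-sym (off-diagonal (i≢j ∘ sym))))

  cayleyMaximumNullity≥ : ∀ {M k} → IsMaximumNullity u Γ M → (F : PrimeFactorisation n) (A : Matrix n) →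
    (∀ {i j} → i ≢ j → A i j ≃ adjacencyMatrix F i j) → EchelonKernel A k → M ≥ k
  cayleyMaximumNullity≥ max F A off-diagonal E =
    maximumNullity≥ max _ (cayleyPattern F A off-diagonal) (permuteEchelon exponents E)

-- The two lower bounds

∈⇒≤sum : ∀ {m ms} → m ∈ ms → m ≤ sum ms
∈⇒≤sum {ms = m ∷ ms} (here refl) = ℕₚ.m≤m+n m (sum ms)
∈⇒≤sum {ms = m ∷ ms} (there m∈)  = ℕₚ.≤-trans (∈⇒≤sum m∈) (ℕₚ.m≤n+m (sum ms) m)

-- If a prime square divides `n`, then `n` is itself a member of `X n`.
φ≤∑φ[X] : ∀ {n} .{{_ : NonZero n}} → DivisibleByPrimeSquare n → φ n ≤ ∑φ (X n)
φ≤∑φ[X] p²∣n = ∈⇒≤sum (∈-map⁺ φ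
  (∈-filter⁺ divisibleByPrimeSquare? (∈-divisors⁺ ∣-refl) p²∣n))

corollary3p3 : ∀ {c ℓ} (G : Group c ℓ) (n : ℕ) (2≤n : 2 ≤ n)
    (u : Enumeration n (Group.setoid G))
    (a : Group.Carrier G) (gen : Generates G a)
    (M : ℕ) → IsMaximumNullity u (cayleyGraph G (unitPowers G n 2≤n u a gen)) M →
    ∀ (d : ℕ) → d ∈ divisors n →
    (DivisibleByPrimeSquare n → M ≥ ∑φ (X n) ⊔ φ d) ×
    (SquareFree n → M ≥ φ d)
corollary3p3 G n 2≤n u a gen M max d d∈ =
  (λ p²∣n → ℕₚ.⊔-lub M≥∑φ[X] (ℕₚ.≤-trans φd≤φn (ℕₚ.≤-trans (φ≤∑φ[X] p²∣n) M≥∑φ[X]))) ,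
  λ sf → ℕₚ.≤-trans φd≤φn
    (cayleyMaximumNullity≥ G n 2≤n u a gen max F (differenceMatrix F)
      (differenceMatrix-off-diagonal F sf) (unitEchelon F sf 2≤n))
  where
  instance
    n≢0 : NonZero n
    n≢0 = ℕ.>-nonZero (ℕₚ.≤-trans (s≤s z≤n) 2≤n)
  F : PrimeFactorisation n
  F = factorise n
  φd≤φn : φ d ≤ φ n
  φd≤φn = φ-∣-mono (proj₁ (∈-divisors⁻ {n = n} d∈))
  r : Radical n
  r = radicalOf n
  open Radical r
  M≥∑φ[X] : M ≥ ∑φ (X n)
  M≥∑φ[X] = ℕₚ.≤-trans (ℕₚ.m+n≤o⇒m≤o∸n (∑φ (X n)) (∑φ[X]+radical≤n n r))
    (cayleyMaximumNullity≥ G n 2≤n u a gen max F (adjacencyMatrix F) (λ _ → ≃-refl)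
      (radicalEchelon F r (sym (ℕₚ.m+[n∸m]≡n (∣⇒≤ radical-∣)))))
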